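{- For every integer $k\ge 2$ there is a constant $M=M(k)>0$, and for every integer $k\geq 2$ and every $\mu\in(0,1)$ there is $M_0=M_0(k,\mu)$, such that the following holds. Suppose that $G$ is a finite abelian group of order at least $M_0$, and that $A\subseteq G$ is $k$-stable. Then there is a subgroup $H\leq G$ of index at most $\exp(\mu^{ -M})$ such that for any $g\in G$, either $|(A-g)\cap H|\leq \mu |H|$ or $|H\setminus (A-g)|\leq \mu|H|$.
   Context: Stability: for a group $G$ (written additively), $A\subseteq G$ and an integer $k\geq 2$, the set $A$ has the $k$-order property if there exist $a_1,\dots,a_k,b_1,\dots,b_k\in G$ such that $a_i+b_j\in A$ if and only if $i\leq j$. The set $A$ is $k$-stable if it does not have the $k$-order property. Notation: $A-g=\{a-g:a\in A\}$. -}

module Defs where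

open import Algebra.Bundles using (AbelianGroup)
import Algebra.Properties.Group as GroupProperties
open import Data.Fin.Base as Fin using (Fin; toℕ)
open import Data.Integer.Base using (+_)
open import Data.List.Base using (List; length; filter; tabulate; deduplicate)
open import Data.Nat.Base using (ℕ; suc; _!)
import Data.Nat.Base as ℕ
open import Data.Nat.Properties using (_!≢0)
open import Data.Product.Base using (Σ-syntax; ∃; ∃₂; ∃-syntax; _×_; _,_)
open import Data.Rational.Base
  using (ℚ; 0ℚ; 1ℚ; _+_; _*_; _/_; _<_; _≤_; +-*-rawSemiring)
open import Algebra.Definitions.RawSemiring +-*-rawSemiring using (_^_; sum)
open import Data.Sum.Base using (_⊎_)
open import Function.Base using (_∘_)
open import Function.Bundles using (Inverse; _⇔_)
open import Level using (Level; 0ℓ; _⊔_) renaming (suc to lsuc)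
open import Relation.Binary.Definitions using (_Respects_)
import Relation.Binary.PropositionalEquality.Properties as ≡
open import Relation.Nullary.Decidable using (map′)
open import Relation.Nullary.Negation using (¬_)
open import Relation.Unary using (Pred; Decidable; _∩_; ∁; _⊆_)
open import Relation.Unary.Properties using (_∩?_; ∁?)

------------------------------------------------------------------------
-- Real numbers

-- Two-sided Dedekind cuts.
record ℝ : Set₁ where
  field
    lower upper     : Pred ℚ 0ℓ
    lower-inhabited : ∃ lower
    upper-inhabited : ∃ upper
    lower-rounded   : ∀ {q} → lower q ⇔ (∃[ r ] q < r × lower r)
    upper-rounded   : ∀ {q} → upper q ⇔ (∃[ r ] r < q × upper r)
    disjoint        : ∀ {q} → ¬ (lower q × upper q)
    located         : ∀ {q r} → q < r → lower q ⊎ upper r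

open ℝ

0<_ : ℝ → Set
0< x = lower x 0ℚ

_<1 : ℝ → Set
x <1 = upper x 1ℚ

-- The numbers that are only compared, never inverted or located, are given
-- by their lower cuts: x is represented by the set of all rationals < x.
-- Then x ≤ y exactly when the lower cut of x is contained in that of y.
LowerCut : Set₁
LowerCut = Pred ℚ 0ℓ

infix 4 _≤ᶜ_
_≤ᶜ_ : LowerCut → LowerCut → Set
x ≤ᶜ y = x ⊆ y

⟦_⟧ : ℕ → LowerCut
⟦ n ⟧ q = q < + n / 1

infixl 7 _·_
_·_ : ℝ → ℕ → LowerCut
(x · n) q = ∃[ r ] lower x r × q < r * (+ n / 1)

-- x to the power -y, for 0 < x < 1 and y > 0.  It is the supremum of
-- s^(-p/d) over rationals s > x and 0 ≤ p/d < y, and for r ≥ 0 one has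
-- r < s^(-p/d) iff r^d s^p < 1.
infixr 8 _^-_
_^-_ : ℝ → ℝ → LowerCut
(x ^- y) r =
  ∃[ s ] upper x s ×
  (∃₂ λ p d-1 → let d = suc d-1 in
    lower y (+ p / d) × (r < 0ℚ ⊎ r ^ d * s ^ p < 1ℚ))

expSum : ℕ → ℚ → ℚ
expSum N r = sum {N} λ i → r ^ toℕ i * (+ 1 / toℕ i !) {{toℕ i !≢0}}

-- q < exp x iff q < exp r for some rational r < x, and q < exp r iff the
-- partial sums of the exponential series at r are eventually ≥ some q′ > q.
exp : LowerCut → LowerCut
exp x q =
  ∃[ r ] x r ×
  (∃[ q′ ] q < q′ × (∃[ N₀ ] (∀ N → N₀ ℕ.≤ N → q′ ≤ expSum N r)))

------------------------------------------------------------------------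
-- Finite abelian groups

record FiniteAbelianGroup c ℓ : Set (lsuc (c ⊔ ℓ)) where
  field
    abelianGroup : AbelianGroup c ℓ

  open AbelianGroup abelianGroup public
    renaming (_∙_ to _+ᴳ_; ε to 0ᴳ; _⁻¹ to -ᴳ_)

  field
    order       : ℕ
    enumeration : Inverse (≡.setoid (Fin order)) setoid

  infixl 6 _-ᴳ_
  _-ᴳ_ : Carrier → Carrier → Carrier
  x -ᴳ y = x +ᴳ (-ᴳ y)

  elements : List Carrier
  elements = tabulate (Inverse.to enumeration)

-- Membership is decidable, as it is classically for every subset; without
-- this the cardinality of a subset would not be defined.
record Subset {c ℓ} (G : FiniteAbelianGroup c ℓ) p : Set (c ⊔ ℓ ⊔ lsuc p) where
  open FiniteAbelianGroup G
  field
    member   : Pred Carrier p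
    respects : member Respects _≈_
    member?  : Decidable member

module _ {c ℓ} {G : FiniteAbelianGroup c ℓ} where
  open FiniteAbelianGroup G
  open Subset
  private variable p p′ : Level

  ∣_∣ : Subset G p → ℕ
  ∣ A ∣ = length (filter (member? A) elements)

  infixr 7 _∩ˢ_
  _∩ˢ_ : Subset G p → Subset G p′ → Subset G (p ⊔ p′)
  A ∩ˢ B = record
    { member   = member A ∩ member B
    ; respects = λ x≈y (a , b) → respects A x≈y a , respects B x≈y b
    ; member?  = member? A ∩? member? B
    }

  infixl 6 _∖ˢ_
  _∖ˢ_ : Subset G p → Subset G p′ → Subset G (p ⊔ p′)
  A ∖ˢ B = record
    { member   = member A ∩ ∁ (member B)
    ; respects = λ x≈y (a , ¬b) → respects A x≈y a , ¬b ∘ respects B (sym x≈y)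
    ; member?  = member? A ∩? ∁? (member? B)
    }

  infixl 8 _-ˢ_
  _-ˢ_ : Subset G p → Carrier → Subset G (c ⊔ ℓ ⊔ p)
  A -ˢ g = record
    { member   = λ x → ∃[ a ] member A a × x ≈ a -ᴳ g
    ; respects = λ x≈y (a , a∈A , x≈a-g) → a , a∈A , trans (sym x≈y) x≈a-g
    ; member?  = λ x → map′
        (λ x+g∈A → x +ᴳ g , x+g∈A , sym (//-rightDividesʳ g x))
        (λ (a , a∈A , x≈a-g) →
          respects A (sym (trans (∙-congʳ x≈a-g) (//-rightDividesˡ g a))) a∈A)
        (member? A (x +ᴳ g))
    }
    where open GroupProperties group using (//-rightDividesˡ; //-rightDividesʳ)

  OrderProperty : ℕ → Subset G p → Set (c ⊔ p)
  OrderProperty k A =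
    Σ[ a ∈ (Fin k → Carrier) ] Σ[ b ∈ (Fin k → Carrier) ]
      (∀ i j → member A (a i +ᴳ b j) ⇔ i Fin.≤ j)

  Stable : ℕ → Subset G p → Set (c ⊔ p)
  Stable k A = ¬ OrderProperty k A

record Subgroup {c ℓ} (G : FiniteAbelianGroup c ℓ) p : Set (c ⊔ ℓ ⊔ lsuc p) where
  open FiniteAbelianGroup G
  field
    subset : Subset G p
  open Subset subset public
  field
    0-closed   : member 0ᴳ
    +-closed   : ∀ {x y} → member x → member y → member (x +ᴳ y)
    neg-closed : ∀ {x} → member x → member (-ᴳ x)

  -- The number of cosets: x and y lie in the same coset iff x - y is in the
  -- subgroup, and deduplication keeps one representative of each coset.
  index : ℕ
  index = length (deduplicate (λ x y → member? (x -ᴳ y)) elements)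

module Submission where

-- The relation A (x + y) of a stable set has no deep binary trees: a tree whose
-- nodes x and leaves y are related according to the branching contains a ladder
-- (Hodges), that is, an instance of the order property.  Let B be a translate
-- of A, restricted to a subgroup H, and call u ∈ H an ε-period if
-- |B ∆ (B - u)| ≤ ε|H|.
--   * If the ε-periods were sparse in H, then repeatedly splitting H by a point
--     x with both B (x + y) and its negation frequent would produce a deep tree;
--     so the ε-periods have density polynomial in ε.
--   * If for each of many scales ε there were an ε-period that is not an
--     ε/2-period, the subset sums of such periods would be the leaves of a deep
--     tree.  So at some scale the ε-periods are closed under addition and form a
--     subgroup S of H of index polynomial in 1/ε.
--   * If B has density between μ and 1 - μ in H, then one coset of S is nearly
--     contained in B and another is nearly disjoint from B.
-- Passing from H to S as long as some translate of A is not nearly trivial on H,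
-- the chosen cosets again assemble to a tree of depth the number of steps.
-- Hence the process stops after boundedly many steps, at a subgroup whose index
-- is even polynomial in 1/μ, and exp x ≥ 1 + x gives the claimed bound.
open import Defs
open import Algebra.Bundles using (AbelianGroup; CommutativeRing)
open import Algebra.Core using (Op₁; Op₂)
import Algebra.Properties.AbelianGroup as AbelianGroupProperties
open import Algebra.Structures using (IsAbelianGroup)
open import Data.Bool.Base using (Bool; true; false; _∧_; _∨_; not; _xor_; T)
import Data.Bool.Properties as Bool
open import Data.Fin.Base as Fin using (Fin; zero; suc; toℕ; fromℕ; inject₁)
open import Data.Fin.Permutation using (permutation)
open import Data.Fin.Properties using (toℕ-inject₁; toℕ-fromℕ; toℕ<n; any?)
open import Data.Fin.Relation.Unary.Top using (view; ‵fromℕ; ‵inj₁)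
open import Data.List.Base using (List; []; _∷_; length; _++_; map; filter; tabulate; deduplicate)
open import Data.List.Membership.Propositional using (_∈_)
open import Data.List.Membership.Propositional.Properties using (∈-++⁺ˡ; ∈-++⁺ʳ; ∈-++⁻; ∈-map⁺; ∈-map⁻)
open import Data.List.Properties using (length-++; length-map)
open import Data.List.Relation.Unary.All using (All; []; _∷_)
open import Data.List.Relation.Unary.All.Properties using (all-filter)
open import Data.List.Relation.Unary.AllPairs as AllPairs using (AllPairs; []; _∷_)
import Data.List.Relation.Unary.AllPairs.Properties as AllPairs
open import Data.List.Relation.Unary.Any using (here; there)
open import Data.Nat.Tactic.RingSolver using (solve-∀)
open import Data.Product.Base using (Σ-syntax; ∃; ∃-syntax; _×_; _,_; proj₁; proj₂)
open import Data.Sum.Base as Sum using (_⊎_; inj₁; inj₂)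
open import Data.Unit.Base using (tt)
open import Function.Base using (_∘_; id; _$_)
open import Function.Bundles using (Inverse; Equivalence; _⇔_; mk⇔)
open import Level using (Level; 0ℓ; _⊔_; Lift; lift)
open import Relation.Binary.Definitions using () renaming (Decidable to Decidable₂)
open import Relation.Binary.PropositionalEquality hiding ([_])
open import Relation.Nullary.Decidable using (Dec; does; yes; no; _×-dec_; map′; does-⇔; dec-true; ¬?)
open import Relation.Nullary.Negation using (¬_; contradiction)
open import Relation.Unary using (Pred; Decidable; U; _⊆_)

-- Rational and real estimates

module Reals where
  open import Data.Integer.Base as ℤ using (+_)
  import Data.Integer.Properties as ℤ
  open import Data.Nat.Base as ℕ using (ℕ; zero; suc; _!)
  import Data.Nat.Properties as ℕ
  open import Data.Rational.Base
  open import Data.Rational.Properties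
  import Data.Rational.Unnormalised.Base as ℚᵘ
  import Data.Rational.Unnormalised.Properties as ℚᵘ
  open import Algebra.Definitions.RawSemiring +-*-rawSemiring using (_^_; sum)
  open import Algebra.Properties.Semiring.Exp (CommutativeRing.semiring +-*-commutativeRing) using (^-assocʳ)

  ι : ℕ → ℚ
  ι n = + n / 1

  toℚᵘ-ι : ∀ n → toℚᵘ (ι n) ℚᵘ.≃ ℚᵘ.mkℚᵘ (+ n) 0
  toℚᵘ-ι n = toℚᵘ-fromℚᵘ (ℚᵘ.mkℚᵘ (+ n) 0)

  ι-mono-≤ : ∀ {m n} → m ℕ.≤ n → ι m ≤ ι n
  ι-mono-≤ {m} {n} m≤n = toℚᵘ-cancel-≤
    (ℚᵘ.≤-respˡ-≃ (ℚᵘ.≃-sym (toℚᵘ-ι m)) (ℚᵘ.≤-respʳ-≃ (ℚᵘ.≃-sym (toℚᵘ-ι n))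
      (ℚᵘ.*≤* (ℤ.*-monoʳ-≤-nonNeg (+ 1) (ℤ.+≤+ m≤n)))))

  ι-mono-< : ∀ {m n} → m ℕ.< n → ι m < ι n
  ι-mono-< {m} {n} m<n = toℚᵘ-cancel-<
    (ℚᵘ.<-respˡ-≃ (ℚᵘ.≃-sym (toℚᵘ-ι m)) (ℚᵘ.<-respʳ-≃ (ℚᵘ.≃-sym (toℚᵘ-ι n))
      (ℚᵘ.*<* (ℤ.*-monoʳ-<-pos (+ 1) (ℤ.+<+ m<n)))))

  ι-* : ∀ m n → ι (m ℕ.* n) ≡ ι m * ι n
  ι-* m n = toℚᵘ-injective (ℚᵘ.≃-trans (toℚᵘ-ι (m ℕ.* n)) (ℚᵘ.≃-trans
    (ℚᵘ.*≡* (cong (ℤ._* + 1) (ℤ.pos-* m n)))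
    (ℚᵘ.≃-sym (ℚᵘ.≃-trans (toℚᵘ-homo-* (ι m) (ι n)) (ℚᵘ.*-cong (toℚᵘ-ι m) (toℚᵘ-ι n))))))

  ι-nonNeg : ∀ n → NonNegative (ι n)
  ι-nonNeg n = nonNegative (ι-mono-≤ {0} {n} ℕ.z≤n)

  -- The product is the numerator of q, a positive integer.
  1≤*ι-denominator : ∀ q → 0ℚ < q → 1ℚ ≤ q * ι (↧ₙ q)
  1≤*ι-denominator q@(mkℚ (+ suc a) d _) _ = toℚᵘ-cancel-≤
    (ℚᵘ.≤-respʳ-≃ (ℚᵘ.≃-sym (ℚᵘ.≃-trans (toℚᵘ-homo-* q (ι (suc d)))
      (ℚᵘ.*-congˡ {toℚᵘ q} (toℚᵘ-ι (suc d)))))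
      (ℚᵘ.*≤* (ℤ.+≤+ (ℕ.≤-trans (ℕ.≤-reflexive (le d))
        (ℕ.≤-trans (ℕ.m≤n*m (suc d) (suc a)) (ℕ.≤-reflexive (sym (ℕ.*-identityʳ _))))))))
    where
    le : ∀ d → 1 ℕ.* (suc d ℕ.* 1) ≡ suc d
    le = solve-∀
  1≤*ι-denominator (mkℚ (+ 0) d _) 0<q = contradiction 0<q λ { (*<* (ℤ.+<+ ())) }
  1≤*ι-denominator (mkℚ (ℤ.-[1+ a ]) d _) 0<q = contradiction 0<q λ { (*<* ()) }

  1ℚ^n≡1 : ∀ n → 1ℚ ^ n ≡ 1ℚ
  1ℚ^n≡1 zero    = refl
  1ℚ^n≡1 (suc n) = trans (*-identityˡ _) (1ℚ^n≡1 n)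

  ^-nonNeg : ∀ x .{{_ : NonNegative x}} n → NonNegative (x ^ n)
  ^-nonNeg x zero    = _
  ^-nonNeg x (suc n) = nonNeg*nonNeg⇒nonNeg x (x ^ n) {{^-nonNeg x n}}

  ^-pos : ∀ x .{{_ : Positive x}} n → Positive (x ^ n)
  ^-pos x zero    = _
  ^-pos x (suc n) = pos*pos⇒pos x (x ^ n) {{^-pos x n}}

  ^-monoˡ-≤ : ∀ {x y} n .{{_ : NonNegative x}} .{{_ : NonNegative y}} → x ≤ y → x ^ n ≤ y ^ n
  ^-monoˡ-≤ zero    x≤y = ≤-refl
  ^-monoˡ-≤ {x} {y} (suc n) x≤y = ≤-trans
    (*-monoʳ-≤-nonNeg (x ^ n) {{^-nonNeg x n}} x≤y)
    (*-monoˡ-≤-nonNeg y (^-monoˡ-≤ n x≤y))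

  *-interchange : ∀ a b c d → (a * b) * (c * d) ≡ (a * c) * (b * d)
  *-interchange a b c d = begin
    (a * b) * (c * d) ≡⟨ *-assoc a b (c * d) ⟩
    a * (b * (c * d)) ≡⟨ cong (a *_) (*-assoc b c d) ⟨
    a * (b * c * d)   ≡⟨ cong (λ e → a * (e * d)) (*-comm b c) ⟩
    a * (c * b * d)   ≡⟨ cong (a *_) (*-assoc c b d) ⟩
    a * (c * (b * d)) ≡⟨ *-assoc a c (b * d) ⟨
    (a * c) * (b * d) ∎
    where open ≡-Reasoning

  ι-2^-suc : ∀ n x y → ι (2 ℕ.^ suc n) * (x * y) ≡ (ι 2 * x) * (ι (2 ℕ.^ n) * y)
  ι-2^-suc n x y = trans (cong (_* (x * y)) (ι-* 2 (2 ℕ.^ n))) (*-interchange (ι 2) (ι (2 ℕ.^ n)) x y)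

  2^n*½^n≡1 : ∀ n → ι (2 ℕ.^ n) * ½ ^ n ≡ 1ℚ
  2^n*½^n≡1 zero    = refl
  2^n*½^n≡1 (suc n) = trans (ι-2^-suc n ½ (½ ^ n)) (trans (*-identityˡ _) (2^n*½^n≡1 n))

  -- The ratio of the grid on which μ is located. Since `2 * ¾ ^ 3 ≤ 1`, its powers absorb powers of
  -- 2; since ½ < ¾, the densities ½^j lie below the grid points.
  ¾ : ℚ
  ¾ = + 3 / 4

  2^n*¾^3n≤1 : ∀ n → ι (2 ℕ.^ n) * (¾ ^ 3) ^ n ≤ 1ℚ
  2^n*¾^3n≤1 zero    = ≤-refl
  2^n*¾^3n≤1 (suc n) = begin
    ι (2 ℕ.^ suc n) * (¾ ^ 3 * (¾ ^ 3) ^ n)       ≡⟨ ι-2^-suc n (¾ ^ 3) ((¾ ^ 3) ^ n) ⟩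
    ι 2 * ¾ ^ 3 * (ι (2 ℕ.^ n) * (¾ ^ 3) ^ n)     ≤⟨ *-monoˡ-≤-nonNeg (ι 2 * ¾ ^ 3) (2^n*¾^3n≤1 n) ⟩
    -- Here 2 · ¾³ = 27/32.
    ι 2 * ¾ ^ 3 * 1ℚ                              ≤⟨ *≤* (ℤ.+≤+ (ℕ.m≤m+n 27 5)) ⟩
    1ℚ                                            ∎
    where open ≤-Reasoning

  ¾^1+n<1 : ∀ n → ¾ ^ suc n < 1ℚ
  ¾^1+n<1 n = ≤-<-trans
    (*-monoˡ-≤-nonNeg ¾ (subst (¾ ^ n ≤_) (1ℚ^n≡1 n) (^-monoˡ-≤ n (*≤* (ℤ.+≤+ (ℕ.m≤m+n 3 1))))))
    (*<* (ℤ.+<+ (ℕ.m≤m+n 4 0)))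

  n≤2^n : ∀ n → n ℕ.≤ 2 ℕ.^ n
  n≤2^n zero    = ℕ.z≤n
  n≤2^n (suc n) = ℕ.+-mono-≤ (ℕ.m^n>0 2 n) (ℕ.≤-trans (n≤2^n n) (ℕ.m≤m+n _ 0))

  -- With k the denominator of q, `k * (¾ ^ 3) ^ k ≤ 2 ^ k * (¾ ^ 3) ^ k ≤ 1 ≤ q * k`, so n = 3k
  -- works.
  archimedean : ∀ q → 0ℚ < q → ∃[ n ] ¾ ^ n ≤ q
  archimedean q 0<q = 3 ℕ.* k , subst (_≤ q) (^-assocʳ ¾ 3 k)
    (*-cancelʳ-≤-pos (ι k) {{positive (ι-mono-< {0} {k} ℕ.z<s)}} (begin
      (¾ ^ 3) ^ k * ι k           ≡⟨ *-comm ((¾ ^ 3) ^ k) (ι k) ⟩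
      ι k * (¾ ^ 3) ^ k
        ≤⟨ *-monoʳ-≤-nonNeg ((¾ ^ 3) ^ k) {{^-nonNeg (¾ ^ 3) k}} (ι-mono-≤ (n≤2^n k)) ⟩
      ι (2 ℕ.^ k) * (¾ ^ 3) ^ k   ≤⟨ 2^n*¾^3n≤1 k ⟩
      1ℚ                          ≤⟨ 1≤*ι-denominator q 0<q ⟩
      q * ι k                     ∎))
    where
    open ≤-Reasoning
    k = ↧ₙ q

  ℕ→ℝ : ℕ → ℝ
  ℕ→ℝ m = record
    { lower           = _< ι m
    ; upper           = ι m <_
    ; lower-inhabited = ι m - 1ℚ ,
        subst (ι m - 1ℚ <_) (+-identityʳ (ι m)) (+-monoʳ-< (ι m) (*<* ℤ.-<+))
    ; upper-inhabited = ι m + 1ℚ ,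
        subst (_< ι m + 1ℚ) (+-identityʳ (ι m)) (+-monoʳ-< (ι m) (*<* (ℤ.+<+ ℕ.z<s)))
    ; lower-rounded   = mk⇔ <-dense (λ (r , q<r , r<m) → <-trans q<r r<m)
    ; upper-rounded   = mk⇔ (λ m<q → let r , m<r , r<q = <-dense m<q in r , r<q , m<r)
                            (λ (r , r<q , m<r) → <-trans m<r r<q)
    ; disjoint        = λ (q<m , m<q) → <-irrefl refl (<-trans q<m m<q)
    ; located         = λ {q} {r} q<r → located q<r
    }
    where
    located : ∀ {q r} → q < r → q < ι m ⊎ ι m < r
    located {q} {r} q<r with ι m ≤? q
    ... | yes m≤q = inj₂ (≤-<-trans m≤q q<r)
    ... | no  m≰q = inj₁ (≰⇒> m≰q)

  module _ (x : ℝ) where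
    open ℝ x

    lower-≤ : ∀ {q r} → q ≤ r → lower r → lower q
    lower-≤ q≤r lr = let s , r<s , ls = Equivalence.to lower-rounded lr in
      Equivalence.from lower-rounded (s , ≤-<-trans q≤r r<s , ls)

    upper-≤ : ∀ {q r} → q ≤ r → upper q → upper r
    upper-≤ q≤r uq = let s , s<q , us = Equivalence.to upper-rounded uq in
      Equivalence.from upper-rounded (s , <-≤-trans s<q q≤r , us)

    -- A cut does not decide on which side of a grid point x lies, so the two bounds are two grid
    -- steps apart. The search walks down the grid, applying `located` to neighbouring points, and
    -- must end before the grid passes a positive rational q below x.
    bracket : 0< x → upper (¾ ^ 1) →
      ∃[ i ] upper (¾ ^ suc i) × lower (¾ ^ (3 ℕ.+ i))
    bracket 0<x u = let q , 0<q , lq = Equivalence.to lower-rounded 0<x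
                        n , ¾ⁿ≤q     = archimedean q 0<q
                    in search n 0 (¾^1+n≤q n ¾ⁿ≤q) lq u
      where
      ¾^1+n≤q : ∀ {q} n → ¾ ^ n ≤ q → ¾ ^ suc n ≤ q
      ¾^1+n≤q n = ≤-trans (≤-trans
        (*-monoʳ-≤-nonNeg (¾ ^ n) {{^-nonNeg ¾ n}} {¾} {1ℚ} (*≤* (ℤ.+≤+ (ℕ.m≤m+n 3 1))))
        (≤-reflexive (*-identityˡ (¾ ^ n))))
      search : ∀ {q} n i → ¾ ^ suc (i ℕ.+ n) ≤ q → lower q → upper (¾ ^ suc i) →
        ∃[ i ] upper (¾ ^ suc i) × lower (¾ ^ (3 ℕ.+ i))
      search {q} zero    i le lq u =
        contradiction (lq , upper-≤ (subst (λ k → ¾ ^ suc k ≤ q) (ℕ.+-identityʳ i) le) u) disjoint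
      search {q} (suc n) i le lq u with located {¾ ^ (3 ℕ.+ i)} {¾ ^ (2 ℕ.+ i)}
        (subst (¾ ^ (3 ℕ.+ i) <_) (*-identityˡ (¾ ^ (2 ℕ.+ i)))
          (*-monoˡ-<-pos (¾ ^ (2 ℕ.+ i)) {{^-pos ¾ (2 ℕ.+ i)}} {¾} {1ℚ} (*<* (ℤ.+<+ (ℕ.m≤m+n 4 0)))))
      ... | inj₁ l  = i , u , l
      ... | inj₂ u′ = search n (suc i) (subst (λ k → ¾ ^ suc k ≤ q) (ℕ.+-suc i n) le) lq u′

  expTerm : ℚ → ℕ → ℚ
  expTerm r i = r ^ i * (+ 1 / i !) {{i ℕ.!≢0}}

  sum-nonNeg : ∀ {n} (f : Fin n → ℚ) → (∀ i → 0ℚ ≤ f i) → 0ℚ ≤ sum f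
  sum-nonNeg {zero}  f 0≤f = ≤-refl
  sum-nonNeg {suc n} f 0≤f = +-mono-≤ (0≤f zero) (sum-nonNeg (f ∘ suc) (0≤f ∘ suc))

  -- For r ≥ 0 all terms of the series are nonnegative, so its first two terms bound every longer
  -- partial sum from below.
  1+r≤expSum : ∀ r .{{_ : NonNegative r}} N → 2 ℕ.≤ N → 1ℚ + r ≤ expSum N r
  1+r≤expSum r (suc zero) (ℕ.s≤s ())
  1+r≤expSum r (suc (suc N)) _ = +-monoʳ-≤ 1ℚ (begin
    r                             ≡⟨ trans (*-identityʳ (r * 1ℚ)) (*-identityʳ r) ⟨
    expTerm r 1                   ≡⟨ +-identityʳ _ ⟨
    expTerm r 1 + 0ℚ              ≤⟨ +-monoʳ-≤ (expTerm r 1)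
                                       (sum-nonNeg {N} (λ i → expTerm r (2 ℕ.+ toℕ i)) (λ i → term≥0 (2 ℕ.+ toℕ i))) ⟩
    expTerm r 1 + sum {N} (λ i → expTerm r (2 ℕ.+ toℕ i)) ∎)
    where
    open ≤-Reasoning
    term≥0 : ∀ i → 0ℚ ≤ expTerm r i
    term≥0 i = nonNegative⁻¹ (expTerm r i)
      {{nonNeg*nonNeg⇒nonNeg (r ^ i) {{^-nonNeg r i}} ((+ 1 / i !) {{i ℕ.!≢0}})
        {{normalize-nonNeg 1 (i !) {{i ℕ.!≢0}}}}}}

  ⟦1⟧≤exp : ∀ x m → 0 ℕ.< m → x <1 → ⟦ 1 ⟧ ≤ᶜ exp (x ^- ℕ→ℝ m)
  ⟦1⟧≤exp x m 0<m x<1 {q} q<1 =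
    -- The rational 0 lies below the power by the choice s = 1 and exponent 0/1, and exp 0 ≥ 1.
    0ℚ , (1ℚ , x<1 , 0 , 0 , ι-mono-< 0<m , inj₂ (*<* (ℤ.+<+ ℕ.z<s))) ,
    1ℚ , q<1 , 2 , 1+r≤expSum 0ℚ

  -- At s = ¾^(i+1) > x the bound reads 2^((i+1)E) s^(3E+1) ≤ s < 1, as 2 ¾³ ≤ 1.
  ⟦⟧≤exp : ∀ E i x {N} → ℝ.upper x (¾ ^ suc i) → N ℕ.≤ 2 ℕ.^ (suc i ℕ.* E) →
    ⟦ N ⟧ ≤ᶜ exp (x ^- ℕ→ℝ (suc (suc (3 ℕ.* E))))
  ⟦⟧≤exp E i x {N} u N≤ {q} q<N =
    ι N ,
    (s , u , suc (3 ℕ.* E) , 0 , ι-mono-< (ℕ.n<1+n (suc (3 ℕ.* E))) , inj₂ small) ,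
    1ℚ + ι N , <-≤-trans q<N N≤1+N , 2 , 1+r≤expSum (ι N) {{ι-nonNeg N}}
    where
    open ≤-Reasoning
    s : ℚ
    s = ¾ ^ suc i
    instance
      s≥0 : NonNegative s
      s≥0 = ^-nonNeg ¾ (suc i)
    k : ℕ
    k = suc i ℕ.* E
    N≤1+N : ι N ≤ 1ℚ + ι N
    N≤1+N = ≤-trans (≤-reflexive (sym (+-identityˡ (ι N)))) (+-monoˡ-≤ (ι N) (nonNegative⁻¹ 1ℚ))
    exponents : ∀ a b → a ℕ.* (3 ℕ.* b) ≡ 3 ℕ.* (a ℕ.* b)
    exponents = solve-∀
    power : s ^ (3 ℕ.* E) ≡ (¾ ^ 3) ^ k
    power = trans (^-assocʳ ¾ (suc i) (3 ℕ.* E))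
      (trans (cong (¾ ^_) (exponents (suc i) E)) (sym (^-assocʳ ¾ 3 k)))
    small : ι N ^ 1 * s ^ suc (3 ℕ.* E) < 1ℚ
    small = begin-strict
      ι N * 1ℚ * (s * s ^ (3 ℕ.* E))     ≡⟨ cong₂ (λ a b → a * (s * b)) (*-identityʳ (ι N)) power ⟩
      ι N * (s * (¾ ^ 3) ^ k)            ≡⟨ *-assoc (ι N) s _ ⟨
      ι N * s * (¾ ^ 3) ^ k              ≡⟨ cong (_* (¾ ^ 3) ^ k) (*-comm (ι N) s) ⟩
      s * ι N * (¾ ^ 3) ^ k              ≡⟨ *-assoc s (ι N) _ ⟩
      s * (ι N * (¾ ^ 3) ^ k)
        ≤⟨ *-monoˡ-≤-nonNeg s (*-monoʳ-≤-nonNeg ((¾ ^ 3) ^ k) {{^-nonNeg (¾ ^ 3) k}} (ι-mono-≤ N≤)) ⟩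
      s * (ι (2 ℕ.^ k) * (¾ ^ 3) ^ k)    ≤⟨ *-monoˡ-≤-nonNeg s (2^n*¾^3n≤1 k) ⟩
      s * 1ℚ                             ≡⟨ *-identityʳ s ⟩
      s                                  <⟨ ¾^1+n<1 i ⟩
      1ℚ                                 ∎

  -- The witness below x is ½^j. This turns an inequality between counts into one about real
  -- densities.
  ⟦⟧≤· : ∀ x j {a b} → ℝ.lower x (½ ^ j) → 2 ℕ.^ j ℕ.* a ℕ.≤ b → ⟦ a ⟧ ≤ᶜ x · b
  ⟦⟧≤· x j {a} {b} l le q<a = ½ ^ j , l , <-≤-trans q<a (begin
    ι a                            ≡⟨ *-identityˡ (ι a) ⟨
    1ℚ * ι a                       ≡⟨ cong (_* ι a) (trans (*-comm (½ ^ j) _) (2^n*½^n≡1 j)) ⟨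
    ½ ^ j * ι (2 ℕ.^ j) * ι a      ≡⟨ *-assoc (½ ^ j) (ι (2 ℕ.^ j)) (ι a) ⟩
    ½ ^ j * (ι (2 ℕ.^ j) * ι a)    ≡⟨ cong (½ ^ j *_) (ι-* (2 ℕ.^ j) a) ⟨
    ½ ^ j * ι (2 ℕ.^ j ℕ.* a)      ≤⟨ *-monoˡ-≤-nonNeg (½ ^ j) {{^-nonNeg ½ j}} (ι-mono-≤ le) ⟩
    ½ ^ j * ι b                    ∎)
    where open ≤-Reasoning

  ½^≤¾^ : ∀ n → ½ ^ n ≤ ¾ ^ n
  ½^≤¾^ n = ^-monoˡ-≤ n (*≤* (ℤ.+≤+ (ℕ.m≤m+n 4 2)))

  ½<¾ : ½ < ¾ ^ 1
  ½<¾ = *<* (ℤ.+<+ (ℕ.m≤m+n 5 1))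

open import Data.Nat.Base hiding (_⊔_)
open import Data.Nat.Properties
open import Algebra.Properties.Semiring.Sum +-*-semiring
  using (sum; sum-cong-≗; sum-permute; ∑-comm; ∑-distrib-+; *-distribˡ-sum; *-distribʳ-sum)

-- Trees and ladders

-- Equals 2^(k+1) - 2. In `tree⇒ladder` one level goes to the root, and `ramsey` divides the rest
-- into the two heights on either side of the inner sum.
ladderHeight : ℕ → ℕ
ladderHeight zero    = 0
ladderHeight (suc k) = suc (suc (ladderHeight k) + ladderHeight k)

module Trees {X Y : Set} (r : X → Y → Bool) where

  private variable
    Q Q′ : Pred X 0ℓ
    P P′ : Pred Y 0ℓ
    d m n : ℕ

  -- A complete binary tree whose left leaves are unrelated and whose right leaves are related to
  -- the node. The leaf predicate accumulates the constraints imposed by all ancestors.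
  Tree : Pred X 0ℓ → Pred Y 0ℓ → ℕ → Set
  Tree Q P zero    = ∃ P
  Tree Q P (suc d) = ∃[ x ] Q x ×
    Tree Q (λ y → P y × r x y ≡ false) d × Tree Q (λ y → P y × r x y ≡ true) d

  mapTree : Q ⊆ Q′ → P ⊆ P′ → ∀ d → Tree Q P d → Tree Q′ P′ d
  mapTree f g zero    (y , p) = y , g p
  mapTree f g (suc d) (x , q , s , t) =
    x , f q , mapTree f (λ (p , e) → g p , e) d s , mapTree f (λ (p , e) → g p , e) d t

  leaf : ∀ d → Tree Q P d → ∃ P
  leaf zero    t = t
  leaf (suc d) (x , q , s , t) = let y , p , _ = leaf d s in y , p

  -- Only the demand for the root's colour is lowered by one in the subtrees. If either subtree
  -- meets the demand for the other colour, that suffices; otherwise both supply a tree of the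
  -- root's colour, and the root joins them.
  ramsey : ∀ (c : X → Bool) m n → Tree Q P (m + n) →
    Tree (λ x → Q x × c x ≡ true) P m ⊎ Tree (λ x → Q x × c x ≡ false) P n
  ramsey c zero    n       t = inj₁ (leaf n t)
  ramsey c (suc m) zero    t = inj₂ (leaf (suc m + 0) t)
  ramsey {Q} c (suc m) (suc n) (x , q , s , t) with c x in eq
  ... | true  with ramsey c m (suc n) s | ramsey c m (suc n) t
  ...   | inj₂ u | _      = inj₂ (mapTree id proj₁ (suc n) u)
  ...   | inj₁ _ | inj₂ u = inj₂ (mapTree id proj₁ (suc n) u)
  ...   | inj₁ u | inj₁ v = inj₁ (x , (q , eq) , u , v)
  ramsey {Q} c (suc m) (suc n) (x , q , s , t) | false
    with ramsey c (suc m) n (subst (Tree Q _) (+-suc m n) s)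
       | ramsey c (suc m) n (subst (Tree Q _) (+-suc m n) t)
  ...   | inj₁ u | _      = inj₁ (mapTree id proj₁ (suc m) u)
  ...   | inj₂ _ | inj₁ u = inj₁ (mapTree id proj₁ (suc m) u)
  ...   | inj₂ u | inj₂ v = inj₂ (x , (q , eq) , u , v)

  Ladder : Pred X 0ℓ → Pred Y 0ℓ → ℕ → Set
  Ladder Q P k = Σ[ a ∈ (Fin k → X) ] Σ[ b ∈ (Fin k → Y) ]
    (∀ i → Q (a i)) × (∀ j → P (b j)) × (∀ i j → r (a i) (b j) ≡ true ⇔ i Fin.≤ j)

  private
    true⇔ : ∀ {b} {S : Set} → b ≡ true → S → b ≡ true ⇔ S
    true⇔ e s = mk⇔ (λ _ → s) (λ _ → e)

    false⇔ : ∀ {b} {S : Set} → b ≡ false → ¬ S → b ≡ true ⇔ S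
    false⇔ refl ¬s = mk⇔ (λ ()) (λ s → contradiction s ¬s)

  infixr 5 _◃_ _▹_

  _◃_ : ∀ {A : Set} {k} → A → (Fin k → A) → Fin (suc k) → A
  (x ◃ f) zero    = x
  (x ◃ f) (suc i) = f i

  _▹_ : ∀ {A : Set} {k} → (Fin k → A) → A → Fin (suc k) → A
  (f ▹ x) i with view i
  ... | ‵fromℕ          = x
  ... | ‵inj₁ {i = j} _ = f j

  ladder-cons : ∀ {x y k} → Q x → P y → r x y ≡ true →
    Ladder (λ x′ → Q x′ × r x′ y ≡ false) (λ y′ → P y′ × r x y′ ≡ true) k →
    Ladder Q P (suc k)
  ladder-cons {Q} {P} {x} {y} {k} q p e (a , b , qa , pb , ab) =
    x ◃ a , y ◃ b , qa′ , pb′ , ab′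
    where
    qa′ : ∀ i → Q ((x ◃ a) i)
    qa′ zero    = q
    qa′ (suc i) = proj₁ (qa i)
    pb′ : ∀ j → P ((y ◃ b) j)
    pb′ zero    = p
    pb′ (suc j) = proj₁ (pb j)
    ab′ : ∀ i j → r ((x ◃ a) i) ((y ◃ b) j) ≡ true ⇔ i Fin.≤ j
    ab′ zero    zero    = true⇔ e z≤n
    ab′ zero    (suc j) = true⇔ (proj₂ (pb j)) z≤n
    ab′ (suc i) zero    = false⇔ (proj₂ (qa i)) (λ ())
    ab′ (suc i) (suc j) = mk⇔ (s≤s ∘ Equivalence.to (ab i j)) (Equivalence.from (ab i j) ∘ s≤s⁻¹)

  ladder-snoc : ∀ {x y k} → Q x → P y → r x y ≡ true →
    Ladder (λ x′ → Q x′ × r x′ y ≡ true) (λ y′ → P y′ × r x y′ ≡ false) k →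
    Ladder Q P (suc k)
  ladder-snoc {Q} {P} {x} {y} {k} q p e (a , b , qa , pb , ab) =
    a ▹ x , b ▹ y , qa′ , pb′ , ab′
    where
    inject₁≤fromℕ : ∀ (i : Fin k) → inject₁ i Fin.≤ fromℕ k
    inject₁≤fromℕ i rewrite toℕ-inject₁ i | toℕ-fromℕ k = <⇒≤ (toℕ<n i)
    fromℕ≰inject₁ : ∀ (i : Fin k) → ¬ fromℕ k Fin.≤ inject₁ i
    fromℕ≰inject₁ i le rewrite toℕ-inject₁ i | toℕ-fromℕ k = <⇒≱ (toℕ<n i) le
    qa′ : ∀ i → Q ((a ▹ x) i)
    qa′ i with view i
    ... | ‵fromℕ          = q
    ... | ‵inj₁ {i = i} _ = proj₁ (qa i)
    pb′ : ∀ j → P ((b ▹ y) j)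
    pb′ j with view j
    ... | ‵fromℕ          = p
    ... | ‵inj₁ {i = j} _ = proj₁ (pb j)
    ab′ : ∀ i j → r ((a ▹ x) i) ((b ▹ y) j) ≡ true ⇔ i Fin.≤ j
    ab′ i j with view i | view j
    ... | ‵fromℕ          | ‵fromℕ          = true⇔ e ≤-refl
    ... | ‵fromℕ          | ‵inj₁ {i = j} _ = false⇔ (proj₂ (pb j)) (fromℕ≰inject₁ j)
    ... | ‵inj₁ {i = i} _ | ‵fromℕ          = true⇔ (proj₂ (qa i)) (inject₁≤fromℕ i)
    ... | ‵inj₁ {i = i} _ | ‵inj₁ {i = j} _ = mk⇔
      (subst₂ _≤_ (sym (toℕ-inject₁ i)) (sym (toℕ-inject₁ j)) ∘ Equivalence.to (ab i j))
      (Equivalence.from (ab i j) ∘ subst₂ _≤_ (toℕ-inject₁ i) (toℕ-inject₁ j))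

  -- Colour the nodes of the right subtree of the root a by their relation to
  -- one of its leaves b.  If a large subtree has all nodes unrelated to b, then
  -- (a , b) precedes a ladder found there; otherwise its root together with b
  -- succeeds a ladder found in its left subtree.
  tree⇒ladder : ∀ k → Tree Q P (ladderHeight k) → Ladder Q P k
  tree⇒ladder zero    _ = (λ ()) , (λ ()) , (λ ()) , (λ ()) , (λ ())
  tree⇒ladder (suc k) (a , qa , _ , t)
    with leaf (suc (ladderHeight k) + ladderHeight k) t
  ... | b , pb , ab
    with ramsey (λ x → r x b) (suc (ladderHeight k)) (ladderHeight k) t
  ...   | inj₁ (x , (qx , xb) , s , _) =
    ladder-snoc qx pb xb
      (tree⇒ladder k (mapTree id (λ ((p , _) , f) → p , f) (ladderHeight k) s))
  ...   | inj₂ s = ladder-cons qa pb ab (tree⇒ladder k s)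

-- Counting

≤ᵇ-true⇒≤ : ∀ m n → (m ≤ᵇ n) ≡ true → m ≤ n
≤ᵇ-true⇒≤ m n e = ≤ᵇ⇒≤ m n (subst T (sym e) tt)

≤⇒≤ᵇ-true : ∀ {m n} → m ≤ n → (m ≤ᵇ n) ≡ true
≤⇒≤ᵇ-true {m} {n} le with m ≤ᵇ n | ≤⇒≤ᵇ le
... | true | _ = refl

∧-split : ∀ {a b} → a ∧ b ≡ true → a ≡ true × b ≡ true
∧-split {true} e = refl , e

∧-join : ∀ {a b} → a ≡ true → b ≡ true → a ∧ b ≡ true
∧-join refl e = e

∧-∨-cases : ∀ {a b c} → a ∧ (b ∨ c) ≡ true → a ∧ b ≡ true ⊎ a ∧ c ≡ true
∧-∨-cases {true} {false} e = inj₂ e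
∧-∨-cases {true} {true}  e = inj₁ refl

[_] : Bool → ℕ
[ false ] = 0
[ true  ] = 1

sum-mono-≤ : ∀ {n} {f g : Fin n → ℕ} → (∀ i → f i ≤ g i) → sum f ≤ sum g
sum-mono-≤ {zero}  f≤g = z≤n
sum-mono-≤ {suc n} f≤g = +-mono-≤ (f≤g zero) (sum-mono-≤ (f≤g ∘ suc))

-- The averaging principle by which the double counts below produce a point.
sum-<⇒∃< : ∀ {n} {f g : Fin n → ℕ} → sum f < sum g → ∃[ i ] f i < g i
sum-<⇒∃< {suc n} {f} {g} lt with f zero <? g zero
... | yes lt₀ = zero , lt₀
... | no ≮₀   =
  let i , ltᵢ = sum-<⇒∃< {n} {f ∘ suc} {g ∘ suc}
                  (+-cancelˡ-< (g zero) _ _ (≤-<-trans (+-monoˡ-≤ _ (≮⇒≥ ≮₀)) lt))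
  in suc i , ltᵢ

sum-*-sum : ∀ {m n} (f : Fin m → ℕ) (g : Fin n → ℕ) →
  sum (λ i → sum (λ j → f i * g j)) ≡ sum f * sum g
sum-*-sum f g = begin
  sum (λ i → sum (λ j → f i * g j)) ≡⟨ sum-cong-≗ (λ i → *-distribˡ-sum (f i) g) ⟨
  sum (λ i → f i * sum g)           ≡⟨ *-distribʳ-sum (sum g) f ⟨
  sum f * sum g                     ∎
  where open ≡-Reasoning

module _ {n : ℕ} where

  # : (Fin n → Bool) → ℕ
  # P = sum λ i → [ P i ]

  private variable P Q R : Fin n → Bool

  #-cong : P ≗ Q → # P ≡ # Q
  #-cong e = sum-cong-≗ λ i → cong [_] (e i)

  #-cover : (∀ i → P i ≡ true → Q i ≡ true ⊎ R i ≡ true) → # P ≤ # Q + # R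
  #-cover {P} {Q} {R} f =
    ≤-trans (sum-mono-≤ pointwise) (≤-reflexive (∑-distrib-+ ([_] ∘ Q) ([_] ∘ R)))
    where
    pointwise : ∀ i → [ P i ] ≤ [ Q i ] + [ R i ]
    pointwise i with P i | f i
    ... | false | _ = z≤n
    ... | true  | h with h refl
    ...   | inj₁ e rewrite e = s≤s z≤n
    ...   | inj₂ e rewrite e = m≤n+m 1 [ Q i ]

  #-mono : (∀ i → P i ≡ true → Q i ≡ true) → # P ≤ # Q
  #-mono {P} {Q} f = sum-mono-≤ pointwise
    where
    pointwise : ∀ i → [ P i ] ≤ [ Q i ]
    pointwise i with P i | f i
    ... | false | _ = z≤n
    ... | true  | h rewrite h refl = ≤-refl

  #-∧-≤ : ∀ (P Q : Fin n → Bool) → # (λ i → P i ∧ Q i) ≤ # P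
  #-∧-≤ P Q = #-mono {P = λ i → P i ∧ Q i} {Q = P} λ i → proj₁ ∘ ∧-split

  #-disjoint : (∀ i → P i ≡ true → ¬ Q i ≡ true) → # P + # Q ≤ # (λ i → P i ∨ Q i)
  #-disjoint {P} {Q} f =
    ≤-trans (≤-reflexive (sym (∑-distrib-+ ([_] ∘ P) ([_] ∘ Q)))) (sum-mono-≤ pointwise)
    where
    pointwise : ∀ i → [ P i ] + [ Q i ] ≤ [ P i ∨ Q i ]
    pointwise i with P i | f i
    ... | false | _ = ≤-refl
    ... | true  | h with Q i | h refl
    ...   | false | _  = ≤-refl
    ...   | true  | h′ = contradiction refl h′

  #-complement : ∀ (P : Fin n → Bool) → # P + # (not ∘ P) ≡ # (λ (_ : Fin n) → true)
  #-complement P = trans (sym (∑-distrib-+ ([_] ∘ P) ([_] ∘ not ∘ P))) (sum-cong-≗ (pointwise ∘ P))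
    where
    pointwise : ∀ b → [ b ] + [ not b ] ≡ 1
    pointwise false = refl
    pointwise true  = refl

  -- Settles the case μ > ½, where the whole group serves as the subgroup.
  #-half : ∀ (P : Fin n → Bool) →
    2 * # P ≤ # (λ (_ : Fin n) → true) ⊎ 2 * # (not ∘ P) ≤ # (λ (_ : Fin n) → true)
  #-half P with ≤-total (# P) (# (not ∘ P))
  ... | inj₁ le = inj₁ (begin
    2 * # P                 ≡⟨ cong (# P +_) (+-identityʳ (# P)) ⟩
    # P + # P               ≤⟨ +-monoʳ-≤ (# P) le ⟩
    # P + # (not ∘ P)       ≡⟨ #-complement P ⟩
    # (λ (_ : Fin n) → true) ∎)
    where open ≤-Reasoning
  ... | inj₂ le = inj₂ (begin
    2 * # (not ∘ P)           ≡⟨ cong (# (not ∘ P) +_) (+-identityʳ (# (not ∘ P))) ⟩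
    # (not ∘ P) + # (not ∘ P) ≤⟨ +-monoˡ-≤ (# (not ∘ P)) le ⟩
    # P + # (not ∘ P)         ≡⟨ #-complement P ⟩
    # (λ (_ : Fin n) → true)  ∎)
    where open ≤-Reasoning

  #>0⇒∃ : 0 < # P → ∃[ i ] P i ≡ true
  #>0⇒∃ {P} lt with sum-<⇒∃< {n} {λ _ → 0} (subst (_< # P) (sym (sum-zero n)) lt)
    where
    sum-zero : ∀ n → sum {n} (λ _ → 0) ≡ 0
    sum-zero zero    = refl
    sum-zero (suc n) = sum-zero n
  ... | i , lt′ with P i in e
  ...   | true = i , e

  ∃⇒#>0 : ∀ i → P i ≡ true → 0 < # P
  ∃⇒#>0 {P} i e = lemma _ i (subst (λ b → 1 ≤ [ b ]) (sym e) ≤-refl)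
    where
    lemma : ∀ {n} (f : Fin n → ℕ) i → 1 ≤ f i → 1 ≤ sum f
    lemma f zero    le = ≤-trans le (m≤m+n _ _)
    lemma f (suc i) le = ≤-trans (lemma (f ∘ suc) i le) (m≤n+m _ (f zero))

  -- The bad sets are removed from P one after the other, each costing at most w/c points. The pair
  -- c, w expresses this fraction without division.
  union-bound : ∀ {T : Set} (bad : T → Fin n → Bool) c w (ts : List T) →
    (∀ {t} → t ∈ ts → c * # (bad t) ≤ w) → length ts * w < c * # P →
    ∃[ z ] P z ≡ true × (∀ {t} → t ∈ ts → bad t z ≡ false)
  union-bound {P} bad c w [] _ lt with # P in e
  ... | zero  = contradiction (subst (0 <_) (*-zeroʳ c) lt) λ ()
  ... | suc _ = let z , p = #>0⇒∃ {P} (subst (0 <_) (sym e) z<s) in z , p , λ ()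
  union-bound {P} bad c w (t ∷ ts) small lt =
    let z , pz , good = union-bound {P′} bad c w ts (small ∘ there) lt′
        p , ¬bad = ∧-split {P z} pz
    in z , p , λ { (here refl) → not-true ¬bad ; (there t∈ts) → good t∈ts }
    where
    P′ : Fin n → Bool
    P′ i = P i ∧ not (bad t i)
    not-true : ∀ {b} → not b ≡ true → b ≡ false
    not-true {false} _ = refl
    cover : ∀ i → P i ≡ true → P′ i ≡ true ⊎ bad t i ≡ true
    cover i e with bad t i
    ... | true  = inj₂ refl
    ... | false = inj₁ (∧-join e refl)
    lt′ : length ts * w < c * # P′
    lt′ = +-cancelʳ-< w _ _ (begin-strict
      length ts * w + w          ≡⟨ +-comm _ w ⟩
      w + length ts * w          <⟨ lt ⟩
      c * # P                    ≤⟨ *-monoʳ-≤ c (#-cover cover) ⟩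
      c * (# P′ + # (bad t))     ≡⟨ *-distribˡ-+ c _ _ ⟩
      c * # P′ + c * # (bad t)   ≤⟨ +-monoʳ-≤ _ (small (here refl)) ⟩
      c * # P′ + w               ∎)
      where open ≤-Reasoning

#-true : ∀ n → # (λ (_ : Fin n) → true) ≡ n
#-true zero    = refl
#-true (suc n) = cong suc (#-true n)

#≤n : ∀ {n} (P : Fin n → Bool) → # P ≤ n
#≤n {n} P = subst (# P ≤_) (#-true n) (#-mono {P = P} {Q = λ _ → true} λ _ _ → refl)

-- Almost-periods in finite abelian groups

module FinGroup {n : ℕ} {op : Op₂ (Fin n)} {unit : Fin n} {inv : Op₁ (Fin n)}
             (isAbelianGroup : IsAbelianGroup _≡_ op unit inv) where

  group : AbelianGroup 0ℓ 0ℓ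
  group = record { isAbelianGroup = isAbelianGroup }

  open AbelianGroup group
    using (_∙_; ε; _⁻¹; assoc; comm; identityʳ; inverseʳ)
  open AbelianGroupProperties group using (//-rightDividesˡ; //-rightDividesʳ)

  #-translate : ∀ (P : Fin n → Bool) u → # (λ x → P (x ∙ u)) ≡ # P
  #-translate P u = sym (sum-permute ([_] ∘ P)
    (permutation (_∙ u) (_∙ u ⁻¹) (//-rightDividesˡ u) (//-rightDividesʳ u)))

  record IsSubgroup (H : Fin n → Bool) : Set where
    field
      ε-closed  : H ε ≡ true
      ∙-closed  : ∀ {x y} → H x ≡ true → H y ≡ true → H (x ∙ y) ≡ true
      ⁻¹-closed : ∀ {x} → H x ≡ true → H (x ⁻¹) ≡ true

    #>0 : 0 < # H
    #>0 = ∃⇒#>0 ε ε-closed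

    translate : ∀ {u} x → H u ≡ true → H (x ∙ u) ≡ H x
    translate {u} x hu with H x in ex | H (x ∙ u) in exu
    ... | true  | true  = refl
    ... | false | false = refl
    ... | true  | false = trans (sym exu) (∙-closed ex hu)
    ... | false | true  = sym $ trans (sym ex) $
      subst (λ y → H y ≡ true) (//-rightDividesʳ u x) (∙-closed exu (⁻¹-closed hu))

    #-translate-∧ : ∀ (P : Fin n → Bool) {u} → H u ≡ true →
      # (λ x → H x ∧ P (x ∙ u)) ≡ # (λ x → H x ∧ P x)
    #-translate-∧ P {u} hu = begin
      # (λ x → H x ∧ P (x ∙ u))       ≡⟨ #-cong (λ x → cong (_∧ P (x ∙ u)) (translate x hu)) ⟨
      # (λ x → H (x ∙ u) ∧ P (x ∙ u)) ≡⟨ #-translate (λ x → H x ∧ P x) u ⟩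
      # (λ x → H x ∧ P x)             ∎
      where open ≡-Reasoning

  everything : IsSubgroup (λ _ → true)
  everything = record
    { ε-closed = refl ; ∙-closed = λ _ _ → refl ; ⁻¹-closed = λ _ → refl }

  -- The cosets of pairwise incongruent elements are disjoint and have `# H` points each, all among
  -- n points. This bounds the index.
  distinct-cosets : ∀ {H} → IsSubgroup H → ∀ {xs} →
    AllPairs (λ x y → ¬ H (x ∙ y ⁻¹) ≡ true) xs → length xs * # H ≤ n
  distinct-cosets {H} isSub {xs} ps = ≤-trans (count ps) (#≤n (cosets xs))
    where
    open IsSubgroup isSub
    cosets : List (Fin n) → Fin n → Bool
    cosets []       y = false
    cosets (x ∷ xs) y = H (y ∙ x ⁻¹) ∨ cosets xs y

    difference : ∀ x y z → z ∙ y ⁻¹ ∙ (z ∙ x ⁻¹) ⁻¹ ≡ x ∙ y ⁻¹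
    difference x y z = begin
      z ∙ y ⁻¹ ∙ (z ∙ x ⁻¹) ⁻¹
        ≡⟨ cong (λ w → w ∙ y ⁻¹ ∙ (z ∙ x ⁻¹) ⁻¹) (//-rightDividesˡ x z) ⟨
      z ∙ x ⁻¹ ∙ x ∙ y ⁻¹ ∙ (z ∙ x ⁻¹) ⁻¹
        ≡⟨ cong (_∙ (z ∙ x ⁻¹) ⁻¹) (trans (assoc _ _ _) (comm _ _)) ⟩
      x ∙ y ⁻¹ ∙ (z ∙ x ⁻¹) ∙ (z ∙ x ⁻¹) ⁻¹
        ≡⟨ //-rightDividesʳ (z ∙ x ⁻¹) (x ∙ y ⁻¹) ⟩
      x ∙ y ⁻¹ ∎
      where open ≡-Reasoning

    disjoint : ∀ {x xs} → All (λ y → ¬ H (x ∙ y ⁻¹) ≡ true) xs →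
      ∀ z → H (z ∙ x ⁻¹) ≡ true → ¬ cosets xs z ≡ true
    disjoint {x} {y ∷ _} (p ∷ ps) z hx c with H (z ∙ y ⁻¹) in hy
    ... | true  = p (subst (λ w → H w ≡ true) (difference x y z) (∙-closed hy (⁻¹-closed hx)))
    ... | false = disjoint ps z hx c

    count : ∀ {xs} → AllPairs (λ x y → ¬ H (x ∙ y ⁻¹) ≡ true) xs →
      length xs * # H ≤ # (cosets xs)
    count []                = z≤n
    count {x ∷ xs} (p ∷ ps) = begin
      # H + length xs * # H                  ≤⟨ +-monoʳ-≤ (# H) (count ps) ⟩
      # H + # (cosets xs)                    ≡⟨ cong (_+ _) (#-translate H (x ⁻¹)) ⟨
      # (λ y → H (y ∙ x ⁻¹)) + # (cosets xs) ≤⟨ #-disjoint (disjoint p) ⟩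
      # (cosets (x ∷ xs))                    ∎
      where open ≤-Reasoning

  module Distance {H : Fin n → Bool} (isSub : IsSubgroup H) (B : Fin n → Bool) where
    open IsSubgroup isSub

    -- The size within H of the symmetric difference of B and B - u. For u and v in H, the number
    -- `dist (u ⁻¹ ∙ v)` is a translation-invariant pseudometric.
    dist : Fin n → ℕ
    dist u = # λ x → H x ∧ (B x xor B (x ∙ u))

    xor-irrefl : ∀ b → b xor b ≡ false
    xor-irrefl false = refl
    xor-irrefl true  = refl

    xor-trans : ∀ a b c → a xor c ≡ true → a xor b ≡ true ⊎ b xor c ≡ true
    xor-trans false false c e = inj₂ e
    xor-trans false true  c e = inj₁ refl
    xor-trans true  false c e = inj₁ refl
    xor-trans true  true  c e = inj₂ e

    dist-ε : dist ε ≡ 0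
    dist-ε with dist ε in eq
    ... | zero  = refl
    ... | suc _ =
      let x , e = #>0⇒∃ {P = λ x → H x ∧ (B x xor B (x ∙ ε))} (subst (0 <_) (sym eq) z<s)
          B≢B   = proj₂ (∧-split {H x} e)
      in contradiction (trans (sym B≢B)
           (trans (cong (λ y → B x xor B y) (identityʳ x)) (xor-irrefl (B x)))) λ ()

    dist-translate : ∀ {u} v → H u ≡ true →
      # (λ x → H x ∧ (B (x ∙ u) xor B (x ∙ (u ∙ v)))) ≡ dist v
    dist-translate {u} v hu = begin
      # (λ x → H x ∧ (B (x ∙ u) xor B (x ∙ (u ∙ v))))
        ≡⟨ #-cong (λ x → cong (λ y → H x ∧ (B (x ∙ u) xor B y)) (assoc x u v)) ⟨
      # (λ x → H x ∧ (B (x ∙ u) xor B (x ∙ u ∙ v)))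
        ≡⟨ #-translate-∧ (λ x → B x xor B (x ∙ v)) hu ⟩
      dist v ∎
      where open ≡-Reasoning

    -- The triangle inequality through the value at `x ∙ u`; the second leg becomes `dist v` when H
    -- is translated by u.
    dist-∙ : ∀ {u} v → H u ≡ true → dist (u ∙ v) ≤ dist u + dist v
    dist-∙ {u} v hu = subst (λ k → dist (u ∙ v) ≤ dist u + k) (dist-translate v hu)
      (#-cover λ x e → let hx , d = ∧-split {H x} e in
        case-⊎ hx (xor-trans (B x) (B (x ∙ u)) (B (x ∙ (u ∙ v))) d))
      where
      case-⊎ : ∀ {a b c} → a ≡ true → b ≡ true ⊎ c ≡ true → a ∧ b ≡ true ⊎ a ∧ c ≡ true
      case-⊎ refl e = e

    dist-⁻¹ : ∀ {u} → H u ≡ true → dist (u ⁻¹) ≡ dist u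
    dist-⁻¹ {u} hu = begin
      dist (u ⁻¹)                                         ≡⟨ dist-translate (u ⁻¹) hu ⟨
      # (λ x → H x ∧ (B (x ∙ u) xor B (x ∙ (u ∙ u ⁻¹))))
        ≡⟨ #-cong (λ x → cong (H x ∧_) (trans (Bool.xor-comm (B (x ∙ u)) _)
             (cong (λ y → B y xor B (x ∙ u)) (trans (cong (x ∙_) (inverseʳ u)) (identityʳ x))))) ⟩
      dist u                                              ∎
      where open ≡-Reasoning

    -- The almost-periods of B in H, with tolerance 1/m.
    stab : ℕ → Fin n → Bool
    stab m u = H u ∧ (m * dist u ≤ᵇ # H)

    stab⁻ : ∀ m {u} → stab m u ≡ true → H u ≡ true × m * dist u ≤ # H
    stab⁻ m {u} e = let hu , le = ∧-split {H u} e in hu , ≤ᵇ-true⇒≤ _ _ le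

    stab⁺ : ∀ m {u} → H u ≡ true → m * dist u ≤ # H → stab m u ≡ true
    stab⁺ m hu le = ∧-join hu (≤⇒≤ᵇ-true le)

    ε∈stab : ∀ m → stab m ε ≡ true
    ε∈stab m = stab⁺ m ε-closed
      (subst (_≤ # H) (sym (trans (cong (m *_) dist-ε) (*-zeroʳ m))) z≤n)

    Gap : ℕ → Set
    Gap m = ∀ {u} → H u ≡ true → m * dist u ≤ # H → 2 * m * dist u ≤ # H

    -- The gap improves the tolerance of both summands from 1/m to 1/(2m), and the triangle
    -- inequality brings their sum back to 1/m.
    gap⇒subgroup : ∀ {m} → Gap m → IsSubgroup (stab m)
    gap⇒subgroup {m} gap = record
      { ε-closed  = ε∈stab m
      ; ∙-closed  = λ {x} {y} ex ey →
          let hx , lx = stab⁻ m ex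
              hy , ly = stab⁻ m ey
          in stab⁺ m (∙-closed hx hy) (*-cancelˡ-≤ 2 (begin
               2 * (m * dist (x ∙ y))              ≡⟨ *-assoc 2 m _ ⟨
               2 * m * dist (x ∙ y)                ≤⟨ *-monoʳ-≤ (2 * m) (dist-∙ y hx) ⟩
               2 * m * (dist x + dist y)           ≡⟨ *-distribˡ-+ (2 * m) _ _ ⟩
               2 * m * dist x + 2 * m * dist y     ≤⟨ +-mono-≤ (gap hx lx) (gap hy ly) ⟩
               # H + # H                           ≡⟨ cong (# H +_) (+-identityʳ (# H)) ⟨
               2 * # H                             ∎))
      ; ⁻¹-closed = λ ex → let hx , lx = stab⁻ m ex in
          stab⁺ m (⁻¹-closed hx) (subst (λ d → m * d ≤ # H) (sym (dist-⁻¹ hx)) lx)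
      }
      where open ≤-Reasoning

-- Constants and their growth

-- A period u is not disturbed by 2^d leaves t with scale d * dist t ≤ d * dist u:
-- together they spoil at most 2^d * 2 * (d / scale d) * dist u < dist u points.
scale : ℕ → ℕ
scale d = suc (2 * (2 ^ d * d))

-- The factor by which the scale may grow while `gap-or-tree` searches for a gap: a failure with d
-- levels left below multiplies the scale by `2 * scale d`.
gapLoss : ℕ → ℕ
gapLoss zero    = 1
gapLoss (suc d) = 2 * scale d * gapLoss d

gapLoss≢0 : ∀ d → NonZero (gapLoss d)
gapLoss≢0 zero    = _
gapLoss≢0 (suc d) = m*n≢0 (2 * scale d) (gapLoss d) {{_}} {{gapLoss≢0 d}}

-- Each of 2^d leaves spoils fewer than 2 / margin d of the points of the subgroup.
margin : ℕ → ℕ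
margin d = suc (2 ^ d * 2)

-- The index bound for one passage from H to S: the bound of `packing` at height D for the largest
-- scale that `gap-or-tree` can return. The product of these bounds is `loss`.
stepLoss : ℕ → ℕ → ℕ → ℕ
stepLoss D M d = (4 * (margin d * M * gapLoss D)) ^ D * 2

loss : ℕ → ℕ → ℕ → ℕ
loss D M zero    = 1
loss D M (suc d) = stepLoss D M d * loss D M d

^-distribʳ-* : ∀ d m n → (m * n) ^ d ≡ m ^ d * n ^ d
^-distribʳ-* zero    m n = refl
^-distribʳ-* (suc d) m n =
  trans (cong (m * n *_) (^-distribʳ-* d m n)) (interchange m n (m ^ d) (n ^ d))
  where
  interchange : ∀ a b c d → a * b * (c * d) ≡ a * c * (b * d)
  interchange = solve-∀

-- Neither `gapLoss` nor `margin` involves M, so every step contributes a constant times `M ^ D`.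
loss-polynomial : ∀ D d → ∃[ c ] ∃[ e ] (∀ M → loss D M d ≡ c * M ^ e)
loss-polynomial D zero    = 1 , 0 , λ M → refl
loss-polynomial D (suc d) with loss-polynomial D d
... | c , e , eq = k ^ D * 2 * c , D + e , λ M → begin
  stepLoss D M d * loss D M d              ≡⟨ cong₂ (λ s t → s ^ D * 2 * t) (factor M) (eq M) ⟩
  (k * M) ^ D * 2 * (c * M ^ e)            ≡⟨ cong (λ s → s * 2 * (c * M ^ e)) (^-distribʳ-* D k M) ⟩
  k ^ D * M ^ D * 2 * (c * M ^ e)          ≡⟨ regroup (k ^ D) (M ^ D) c (M ^ e) ⟩
  k ^ D * 2 * c * (M ^ D * M ^ e)          ≡⟨ cong (k ^ D * 2 * c *_) (^-distribˡ-+-* M D e) ⟨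
  k ^ D * 2 * c * M ^ (D + e)              ∎
  where
  open ≡-Reasoning
  k : ℕ
  k = 4 * (margin d * gapLoss D)
  commute : ∀ a b c → 4 * (a * b * c) ≡ 4 * (a * c) * b
  commute = solve-∀
  factor : ∀ M → 4 * (margin d * M * gapLoss D) ≡ k * M
  factor M = commute (margin d) M (gapLoss D)
  regroup : ∀ a b c d → a * b * 2 * (c * d) ≡ a * 2 * c * (b * d)
  regroup = solve-∀

-- Regularity for sets without deep trees

module Regularity {n : ℕ} {op : Op₂ (Fin n)} {unit : Fin n} {inv : Op₁ (Fin n)}
                  (isAbelianGroup : IsAbelianGroup _≡_ op unit inv)
                  (A : Fin n → Bool) where

  open FinGroup isAbelianGroup
  open AbelianGroup group using (_∙_; ε; _⁻¹; assoc; comm; identityˡ)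
  open AbelianGroupProperties group using (\\-leftDividesˡ; \\-leftDividesʳ)
  open Trees (λ x y → A (x ∙ y))

  -- Relations depend only on the product of node and leaf, so moving leaves by c and nodes by the
  -- inverse of c preserves them all.
  shiftTree : ∀ {P P′ : Pred (Fin n) 0ℓ} c → (∀ {t} → P t → P′ (c ∙ t)) →
    ∀ d → Tree U P d → Tree U P′ d
  shiftTree c f zero    (y , p) = c ∙ y , f p
  shiftTree c f (suc d) (x , _ , s , t) = x ∙ c ⁻¹ , _ ,
    shiftTree c (λ {y} (p , e) → f p , trans (cong A (cancel y)) e) d s ,
    shiftTree c (λ {y} (p , e) → f p , trans (cong A (cancel y)) e) d t
    where
    cancel : ∀ y → x ∙ c ⁻¹ ∙ (c ∙ y) ≡ x ∙ y
    cancel y = trans (assoc x (c ⁻¹) (c ∙ y)) (cong (x ∙_) (\\-leftDividesʳ c y))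

  branches : Fin n → Fin n → List (Fin n) → List (Fin n)
  branches a b ts = map (a ∙_) ts ++ map (b ∙_) ts

  length-branches : ∀ a b ts d → length ts ≡ 2 ^ d → length (branches a b ts) ≡ 2 ^ suc d
  length-branches a b ts d e = begin
    length (branches a b ts)                          ≡⟨ length-++ (map (a ∙_) ts) ⟩
    length (map (a ∙_) ts) + length (map (b ∙_) ts)
      ≡⟨ cong₂ _+_ (length-map (a ∙_) ts) (length-map (b ∙_) ts) ⟩
    length ts + length ts                             ≡⟨ cong₂ _+_ e (trans e (sym (+-identityʳ _))) ⟩
    2 ^ suc d                                         ∎
    where open ≡-Reasoning

  ∈-branches⁻ : ∀ {P : Fin n → Set} a b ts →
    (∀ {t} → t ∈ ts → P (a ∙ t)) → (∀ {t} → t ∈ ts → P (b ∙ t)) →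
    ∀ {t} → t ∈ branches a b ts → P t
  ∈-branches⁻ a b ts fa fb t∈ with ∈-++⁻ (map (a ∙_) ts) t∈
  ... | inj₁ t∈a with _ , t∈ts , refl ← ∈-map⁻ (a ∙_) t∈a = fa t∈ts
  ... | inj₂ t∈b with _ , t∈ts , refl ← ∈-map⁻ (b ∙_) t∈b = fb t∈ts

  -- Two shifted copies of one tree become the subtrees of a new root. The leaves are kept in an
  -- explicit list because x has to treat all leaves of a copy alike.
  joinTrees : ∀ {d ts} x a b → Tree U (_∈ ts) d →
    (∀ {t} → t ∈ ts → A (x ∙ (a ∙ t)) ≡ true × A (x ∙ (b ∙ t)) ≡ false) →
    Tree U (_∈ branches a b ts) (suc d)
  joinTrees {d} {ts} x a b t sep = x , _ ,
    shiftTree b (λ t∈ → ∈-++⁺ʳ (map (a ∙_) ts) (∈-map⁺ (b ∙_) t∈) , proj₂ (sep t∈)) d t ,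
    shiftTree a (λ t∈ → ∈-++⁺ˡ (∈-map⁺ (a ∙_) t∈) , proj₁ (sep t∈)) d t

  module Periods {H : Fin n → Bool} (isSub : IsSubgroup H) (g : Fin n) where
    open IsSubgroup isSub

    B : Fin n → Bool
    B x = A (g ∙ x)

    open Distance isSub B

    -- Sparse almost-periods yield a tree

    module Packing (m : ℕ) where

      module _ (L : Fin n → Bool) (L⊆H : ∀ x → L x ≡ true → H x ≡ true) where

        p q : Fin n → ℕ
        p x = # λ y → L y ∧ B (x ∙ y)
        q x = # λ y → L y ∧ not (B (x ∙ y))

        -- The triples x, y, y′ are counted in two ways: for fixed x in `∑-separates`, for fixed y
        -- and y′ in `separates-pair`.
        separates : Fin n → Fin n → Fin n → ℕ
        separates x y y′ = [ H x ∧ ((L y ∧ L y′) ∧ (B (x ∙ y) xor B (x ∙ y′))) ]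

        private
          xor-expand : ∀ h l l′ b b′ → [ h ∧ ((l ∧ l′) ∧ (b xor b′)) ] ≡
            [ h ] * ([ l ∧ b ] * [ l′ ∧ not b′ ] + [ l ∧ not b ] * [ l′ ∧ b′ ])
          xor-expand false l     l′    b     b′    = refl
          xor-expand true  false l′    b     b′    = refl
          xor-expand true  true  false false b′    = refl
          xor-expand true  true  false true  b′    = refl
          xor-expand true  true  true  false false = refl
          xor-expand true  true  true  false true  = refl
          xor-expand true  true  true  true  false = refl
          xor-expand true  true  true  true  true  = refl

        ∑-separates : ∀ x → sum (λ y → sum λ y′ → separates x y y′) ≡ [ H x ] * (2 * (p x * q x))
        ∑-separates x = begin
          sum (λ y → sum λ y′ → separates x y y′)
            ≡⟨ sum-cong-≗ (λ y → begin
                 sum (λ y′ → separates x y y′)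
                   ≡⟨ sum-cong-≗ (λ y′ → xor-expand (H x) (L y) (L y′) (B (x ∙ y)) (B (x ∙ y′))) ⟩
                 sum (λ y′ → [ H x ] * (b⁺ y * b⁻ y′ + b⁻ y * b⁺ y′))
                   ≡⟨ *-distribˡ-sum [ H x ] (λ y′ → b⁺ y * b⁻ y′ + b⁻ y * b⁺ y′) ⟨
                 [ H x ] * sum (λ y′ → b⁺ y * b⁻ y′ + b⁻ y * b⁺ y′)
                   ≡⟨ cong ([ H x ] *_) (∑-distrib-+ (λ y′ → b⁺ y * b⁻ y′) (λ y′ → b⁻ y * b⁺ y′)) ⟩
                 [ H x ] * (sum (λ y′ → b⁺ y * b⁻ y′) + sum (λ y′ → b⁻ y * b⁺ y′)) ∎) ⟩
          sum (λ y → [ H x ] * (sum (λ y′ → b⁺ y * b⁻ y′) + sum (λ y′ → b⁻ y * b⁺ y′)))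
            ≡⟨ *-distribˡ-sum [ H x ] (λ y → sum (λ y′ → b⁺ y * b⁻ y′) + sum (λ y′ → b⁻ y * b⁺ y′)) ⟨
          [ H x ] * sum (λ y → sum (λ y′ → b⁺ y * b⁻ y′) + sum (λ y′ → b⁻ y * b⁺ y′))
            ≡⟨ cong ([ H x ] *_) (∑-distrib-+ (λ y → sum λ y′ → b⁺ y * b⁻ y′) (λ y → sum λ y′ → b⁻ y * b⁺ y′)) ⟩
          [ H x ] * (sum (λ y → sum λ y′ → b⁺ y * b⁻ y′) + sum (λ y → sum λ y′ → b⁻ y * b⁺ y′))
            ≡⟨ cong ([ H x ] *_) (cong₂ _+_ (sum-*-sum b⁺ b⁻) (sum-*-sum b⁻ b⁺)) ⟩
          [ H x ] * (p x * q x + q x * p x)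
            ≡⟨ cong ([ H x ] *_) (twice (p x) (q x)) ⟩
          [ H x ] * (2 * (p x * q x)) ∎
          where
          open ≡-Reasoning
          b⁺ b⁻ : Fin n → ℕ
          b⁺ y = [ L y ∧ B (x ∙ y) ]
          b⁻ y = [ L y ∧ not (B (x ∙ y)) ]
          twice : ∀ a b → a * b + b * a ≡ 2 * (a * b)
          twice = solve-∀

        -- A point x separates y from y′ when shifting by `y ⁻¹ ∙ y′` changes B at `x ∙ y`. If this
        -- shift is no period, its distance times m exceeds `# H`; the successor records the
        -- strictness.
        separates-pair : ∀ y y′ → L y ≡ true → [ L y′ ∧ not (stab m (y ⁻¹ ∙ y′)) ] * suc (# H) ≤
          m * sum (λ x → separates x y y′)
        separates-pair y y′ ly with L y′ in ly′ | stab m (y ⁻¹ ∙ y′) in far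
        ... | false | _     = z≤n
        ... | true  | true  = z≤n
        ... | true  | false rewrite ly | +-identityʳ (# H) = begin
          suc (# H)
            ≤⟨ ≰⇒> (λ le → contradiction (trans (sym (stab⁺ m hyy′ le)) far) λ ()) ⟩
          m * dist (y ⁻¹ ∙ y′)        ≡⟨ cong (m *_) (dist-translate (y ⁻¹ ∙ y′) hy) ⟨
          m * # (λ x → H x ∧ (B (x ∙ y) xor B (x ∙ (y ∙ (y ⁻¹ ∙ y′)))))
            ≡⟨ cong (m *_) (#-cong λ x →
                 cong (λ z → H x ∧ (B (x ∙ y) xor B (x ∙ z))) (\\-leftDividesˡ y y′)) ⟩
          m * # (λ x → H x ∧ (B (x ∙ y) xor B (x ∙ y′))) ∎
          where
          open ≤-Reasoning
          hy : H y ≡ true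
          hy = L⊆H y ly
          hyy′ : H (y ⁻¹ ∙ y′) ≡ true
          hyy′ = ∙-closed (⁻¹-closed hy) (L⊆H y′ ly′)

        module _ (large : 2 * # (stab m) ≤ # L) where

          -- The y′ that differ from y by a period lie in a translate of `stab m`, which by `large`
          -- has at most half the size of L. So at least half of L is far from y.
          separates-point : ∀ y → [ L y ] * (suc (# H) * # L) ≤
            2 * m * sum (λ y′ → sum λ x → separates x y y′)
          separates-point y with L y in ly
          ... | false = z≤n
          ... | true  = begin
            suc (# H) * # L + 0                     ≡⟨ +-identityʳ _ ⟩
            suc (# H) * # L                         ≤⟨ *-monoʳ-≤ (suc (# H)) L≤2F ⟩
            suc (# H) * (2 * # F)                   ≡⟨ rearrange (suc (# H)) (# F) ⟩
            2 * (# F * suc (# H))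
              ≡⟨ cong (2 *_) (*-distribʳ-sum (suc (# H)) ([_] ∘ F)) ⟩
            2 * sum (λ y′ → [ F y′ ] * suc (# H))
              ≤⟨ *-monoʳ-≤ 2 (sum-mono-≤ λ y′ → separates-pair y y′ ly) ⟩
            2 * sum (λ y′ → m * sum (λ x → separates x y y′))
              ≡⟨ cong (2 *_) (*-distribˡ-sum m (λ y′ → sum λ x → separates x y y′)) ⟨
            2 * (m * sum (λ y′ → sum λ x → separates x y y′)) ≡⟨ *-assoc 2 m _ ⟨
            2 * m * sum (λ y′ → sum λ x → separates x y y′)
              ≡⟨ cong (2 * m *_) (sum-cong-≗ λ y′ → sum-cong-≗ λ x →
                   cong (λ b → [ H x ∧ ((b ∧ L y′) ∧ (B (x ∙ y) xor B (x ∙ y′))) ]) ly) ⟩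
            _ ∎
            where
            open ≤-Reasoning
            rearrange : ∀ a b → a * (2 * b) ≡ 2 * (b * a)
            rearrange = solve-∀
            F near : Fin n → Bool
            F y′ = L y′ ∧ not (stab m (y ⁻¹ ∙ y′))
            near y′ = stab m (y ⁻¹ ∙ y′)
            L≤F+S : # L ≤ # F + # (stab m)
            L≤F+S = begin
              # L           ≤⟨ #-cover split ⟩
              # F + # near  ≡⟨ cong (# F +_) (trans
                                 (#-cong λ y′ → cong (stab m) (comm (y ⁻¹) y′))
                                 (#-translate (stab m) (y ⁻¹))) ⟩
              # F + # (stab m) ∎
              where
              split : ∀ y′ → L y′ ≡ true → F y′ ≡ true ⊎ near y′ ≡ true
              split y′ ly′ with near y′
              ... | true  = inj₂ refl
              ... | false = inj₁ (∧-join ly′ refl)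
            L≤2F : # L ≤ 2 * # F
            L≤2F = +-cancelʳ-≤ (# L) _ _ (begin
              # L + # L                        ≤⟨ +-mono-≤ L≤F+S L≤F+S ⟩
              (# F + # (stab m)) + (# F + # (stab m)) ≡⟨ collect (# F) (# (stab m)) ⟩
              2 * # F + 2 * # (stab m)         ≤⟨ +-monoʳ-≤ (2 * # F) large ⟩
              2 * # F + # L                    ∎)
              where
              collect : ∀ a b → (a + b) + (a + b) ≡ 2 * a + 2 * b
              collect = solve-∀

          -- Averaging over x in H gives some x with `# L * # L < 4 * m * p x * q x`. Since `p x`
          -- and `q x` are at most `# L`, each of them exceeds `# L` divided by 4m.
          splitting-node : 0 < # L → ∃[ x ] H x ≡ true ×
            # L < 4 * m * p x × # L < 4 * m * q x
          splitting-node 0<L =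
            let x , lt = sum-<⇒∃< ∑<∑ in x , split x lt
            where
            open ≤-Reasoning
            instance
              L≢0 : NonZero (# L)
              L≢0 = >-nonZero 0<L
            ∑<∑ : sum (λ x → [ H x ] * (# L * # L)) < sum (λ x → 2 * m * ([ H x ] * (2 * (p x * q x))))
            ∑<∑ = begin-strict
              sum (λ x → [ H x ] * (# L * # L)) ≡⟨ *-distribʳ-sum (# L * # L) ([_] ∘ H) ⟨
              # H * (# L * # L)
                <⟨ *-monoˡ-< (# L * # L) {{m*n≢0 (# L) (# L)}} (n<1+n (# H)) ⟩
              suc (# H) * (# L * # L)           ≡⟨ shuffle (suc (# H)) (# L) ⟩
              # L * (suc (# H) * # L)           ≡⟨ *-distribʳ-sum (suc (# H) * # L) ([_] ∘ L) ⟩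
              sum (λ y → [ L y ] * (suc (# H) * # L)) ≤⟨ sum-mono-≤ separates-point ⟩
              sum (λ y → 2 * m * sum (λ y′ → sum λ x → separates x y y′))
                ≡⟨ *-distribˡ-sum (2 * m) (λ y → sum (λ y′ → sum λ x → separates x y y′)) ⟨
              2 * m * sum (λ y → sum (λ y′ → sum λ x → separates x y y′))
                ≡⟨ cong (2 * m *_) (sum-cong-≗ λ y → ∑-comm (λ y′ x → separates x y y′)) ⟩
              2 * m * sum (λ y → sum (λ x → sum λ y′ → separates x y y′))
                ≡⟨ cong (2 * m *_) (∑-comm (λ y x → sum λ y′ → separates x y y′)) ⟩
              2 * m * sum (λ x → sum (λ y → sum λ y′ → separates x y y′))
                ≡⟨ cong (2 * m *_) (sum-cong-≗ ∑-separates) ⟩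
              2 * m * sum (λ x → [ H x ] * (2 * (p x * q x)))
                ≡⟨ *-distribˡ-sum (2 * m) (λ x → [ H x ] * (2 * (p x * q x))) ⟩
              sum (λ x → 2 * m * ([ H x ] * (2 * (p x * q x)))) ∎
              where
              shuffle : ∀ a b → a * (b * b) ≡ b * (a * b)
              shuffle = solve-∀
            split : ∀ x → [ H x ] * (# L * # L) < 2 * m * ([ H x ] * (2 * (p x * q x))) →
              H x ≡ true × # L < 4 * m * p x × # L < 4 * m * q x
            split x lt with H x
            ... | false = contradiction (subst (0 <_) (*-zeroʳ (2 * m)) lt) λ ()
            ... | true  = refl ,
                *-cancelʳ-< _ _ _ (≤-<-trans (*-monoʳ-≤ (# L) q≤L)
                  (subst₂ _<_ (+-identityʳ _) (left m (p x) (q x)) lt)) ,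
                *-cancelʳ-< _ _ _ (≤-<-trans (*-monoʳ-≤ (# L) p≤L)
                  (subst₂ _<_ (+-identityʳ _) (right m (p x) (q x)) lt))
              where
              p≤L : p x ≤ # L
              p≤L = #-∧-≤ L (λ y → B (x ∙ y))
              q≤L : q x ≤ # L
              q≤L = #-∧-≤ L (λ y → not (B (x ∙ y)))
              left : ∀ a b c → 2 * a * (2 * (b * c) + 0) ≡ 4 * a * b * c
              left = solve-∀
              right : ∀ a b c → 2 * a * (2 * (b * c) + 0) ≡ 4 * a * c * b
              right = solve-∀

      -- Both parts of L at a splitting node keep a fraction 1/(4m) of L, which pays for one level.
      -- The factor `2 * # (stab m)` keeps L large enough to split again. The node is `g ∙ x`
      -- because B is A translated by g.
      packing : .{{NonZero m}} → ∀ d (L : Fin n → Bool) → (∀ x → L x ≡ true → H x ≡ true) →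
        (4 * m) ^ d * (2 * # (stab m)) ≤ # L → Tree U (λ y → L y ≡ true) d
      packing zero    L L⊆H le = #>0⇒∃ (<-≤-trans
        (subst (0 <_) (sym (*-identityˡ _)) (≤-trans (∃⇒#>0 ε (ε∈stab m)) (m≤m+n _ _))) le)
      packing (suc d) L L⊆H le =
        let x , hx , Lp , Lq = splitting-node L L⊆H large 0<L
        in g ∙ x , _ ,
           mapTree id (λ {y} → leaf⁻ x y) d
             (packing d (λ y → L y ∧ not (B (x ∙ y))) (λ y → L⊆H y ∘ proj₁ ∘ ∧-split) (shrink Lq)) ,
           mapTree id (λ {y} → leaf⁺ x y) d
             (packing d (λ y → L y ∧ B (x ∙ y)) (λ y → L⊆H y ∘ proj₁ ∘ ∧-split) (shrink Lp))
        where
        instance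
          4m≢0 : NonZero (4 * m)
          4m≢0 = m*n≢0 4 m
        large : 2 * # (stab m) ≤ # L
        large = ≤-trans (m≤n*m _ ((4 * m) ^ suc d) {{m^n≢0 (4 * m) (suc d)}}) le
        0<L : 0 < # L
        0<L = <-≤-trans (≤-trans (∃⇒#>0 ε (ε∈stab m)) (m≤m+n _ _)) large
        shrink : ∀ {k} → # L < 4 * m * k → (4 * m) ^ d * (2 * # (stab m)) ≤ k
        shrink lt = *-cancelˡ-≤ (4 * m) (≤-trans
          (≤-trans (≤-reflexive (sym (*-assoc (4 * m) ((4 * m) ^ d) _))) le) (<⇒≤ lt))
        leaf⁻ : ∀ x y → L y ∧ not (B (x ∙ y)) ≡ true → L y ≡ true × A (g ∙ x ∙ y) ≡ false
        leaf⁻ x y e rewrite assoc g x y with ly , ¬b ← ∧-split {L y} e =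
          ly , trans (sym (Bool.not-involutive _)) (cong not ¬b)
        leaf⁺ : ∀ x y → L y ∧ B (x ∙ y) ≡ true → L y ≡ true × A (g ∙ x ∙ y) ≡ true
        leaf⁺ x y e rewrite assoc g x y = ∧-split e

    -- The leaves are sums of at most d periods of tolerance 1/m, hence the factor d.
    PeriodTree : ℕ → ℕ → Set
    PeriodTree m d = ∃[ ts ] length ts ≡ 2 ^ d ×
      (∀ {t} → t ∈ ts → H t ≡ true × m * dist t ≤ d * # H) × Tree U (_∈ ts) d

    -- The candidates are the z in H at which shifting by u changes B. Each t spoils at most
    -- `2 * dist t` of them: `dist t` by its effect at z and as many by its effect at `z ∙ u`.
    stable-point : ∀ u (ts : List (Fin n)) K w → H u ≡ true →
      (∀ {t} → t ∈ ts → H t ≡ true × K * dist t ≤ w) →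
      length ts * (2 * w) < K * dist u →
      ∃[ z ] B z xor B (z ∙ u) ≡ true ×
        (∀ {t} → t ∈ ts → B z xor B (z ∙ t) ≡ false × B (z ∙ u) xor B (z ∙ (u ∙ t)) ≡ false)
    stable-point u ts K w hu small lt =
      let z , good , ¬bad = union-bound {P = λ z → H z ∧ (B z xor B (z ∙ u))} bad K (2 * w) ts
            (λ {t} t∈ → bad-small t (small t∈)) lt
          hz , e = ∧-split {H z} good
      in z , e , λ t∈ → not-bad hz (¬bad t∈)
      where
      open ≤-Reasoning
      bad : Fin n → Fin n → Bool
      bad t z = H z ∧ ((B z xor B (z ∙ t)) ∨ (B (z ∙ u) xor B (z ∙ (u ∙ t))))
      not-bad : ∀ {a b c} → a ≡ true → a ∧ (b ∨ c) ≡ false → b ≡ false × c ≡ false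
      not-bad {b = false} refl e = refl , e
      bad-small : ∀ t → H t ≡ true × K * dist t ≤ w → K * # (bad t) ≤ 2 * w
      bad-small t (ht , le) = begin
        K * # (bad t)             ≤⟨ *-monoʳ-≤ K (#-cover λ z → ∧-∨-cases {H z}) ⟩
        K * (dist t + # (λ z → H z ∧ (B (z ∙ u) xor B (z ∙ (u ∙ t)))))
                                  ≡⟨ cong (λ k → K * (dist t + k)) (dist-translate t hu) ⟩
        K * (dist t + dist t)     ≡⟨ double K (dist t) ⟩
        2 * (K * dist t)          ≤⟨ *-monoʳ-≤ 2 le ⟩
        2 * w                     ∎
        where
        double : ∀ a b → a * (b + b) ≡ 2 * (a * b)
        double = solve-∀

    -- If no scale has a gap, there are periods u₀, u₁, … with rapidly decreasing
    -- positive dist.  Their subset sums are the leaves of a tree: at the node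
    -- choosing between 0 and uᵢ, later summands are too short to matter.
    gap-or-tree : ∀ d m .{{_ : NonZero m}} →
      (∃[ m′ ] m ≤ m′ × m′ ≤ m * gapLoss d × Gap m′) ⊎ PeriodTree m d
    gap-or-tree zero m = inj₂
      (ε ∷ [] , refl ,
       (λ { (here refl) → ε-closed , ≤-reflexive (trans (cong (m *_) dist-ε) (*-zeroʳ m)) }) ,
       ε , here refl)
    gap-or-tree (suc d) m
      with any? (λ u → (H u Bool.≟ true) ×-dec (m * dist u ≤? # H) ×-dec (# H <? 2 * m * dist u))
    ... | no ¬u = inj₁ (m , ≤-refl , m≤m*n m (gapLoss (suc d)) {{gapLoss≢0 (suc d)}} ,
                        λ {u} hu le → ≮⇒≥ λ lt → ¬u (u , hu , le , lt))
    -- At the new scale the leaves t satisfy `scale d * dist t ≤ d * dist u`, because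
    -- `# H < 2 * m * dist u`.
    ... | yes (u , hu , le , lt) with gap-or-tree d (m * (2 * scale d)) {{m*n≢0 m (2 * scale d)}}
    ...   | inj₁ (m′ , m≤m′ , m′≤ , gap) =
      inj₁ (m′ , ≤-trans (m≤m*n m (2 * scale d)) m≤m′ ,
            ≤-trans m′≤ (≤-reflexive (*-assoc m (2 * scale d) (gapLoss d))) , gap)
    ...   | inj₂ (ts , len , small , tree) =
      let z , e , same = stable-point u ts (scale d) (d * dist u) hu small′ few
      in inj₂ (extend z e same)
      where
      open ≤-Reasoning
      dist>0 : 0 < dist u
      dist>0 with dist u
      ... | zero  = contradiction (subst (# H <_) (*-zeroʳ (2 * m)) lt) λ ()
      ... | suc _ = z<s
      small′ : ∀ {t} → t ∈ ts → H t ≡ true × scale d * dist t ≤ d * dist u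
      small′ {t} t∈ = let ht , le′ = small t∈ in ht ,
        *-cancelˡ-≤ (2 * m) {{m*n≢0 2 m}} (begin
          2 * m * (scale d * dist t)     ≡⟨ regroup m (scale d) (dist t) ⟩
          m * (2 * scale d) * dist t     ≤⟨ le′ ⟩
          d * # H                        ≤⟨ *-monoʳ-≤ d (<⇒≤ lt) ⟩
          d * (2 * m * dist u)           ≡⟨ swap d (2 * m) (dist u) ⟩
          2 * m * (d * dist u)           ∎)
        where
        regroup : ∀ a b c → 2 * a * (b * c) ≡ a * (2 * b) * c
        regroup = solve-∀
        swap : ∀ a b c → a * (b * c) ≡ b * (a * c)
        swap = solve-∀
      few : length ts * (2 * (d * dist u)) < scale d * dist u
      few = begin-strict
        length ts * (2 * (d * dist u))  ≡⟨ cong (_* (2 * (d * dist u))) len ⟩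
        2 ^ d * (2 * (d * dist u))      ≡⟨ regroup (2 ^ d) d (dist u) ⟩
        -- Strict by the summand 1 in `scale d` and by `dist u > 0`.
        2 * (2 ^ d * d) * dist u        <⟨ m<n+m _ dist>0 ⟩
        scale d * dist u                ∎
        where
        regroup : ∀ a b c → a * (2 * (b * c)) ≡ 2 * (a * b) * c
        regroup = solve-∀
      coarse : ∀ {t} → t ∈ ts → m * dist t ≤ d * # H
      coarse {t} t∈ = begin
        m * dist t                  ≤⟨ *-monoˡ-≤ (dist t) (m≤m*n m (2 * scale d)) ⟩
        m * (2 * scale d) * dist t  ≤⟨ proj₂ (small t∈) ⟩
        d * # H                     ∎
      module _ {z} (e : B z xor B (z ∙ u) ≡ true)
               (same : ∀ {t} → t ∈ ts →
                 B z xor B (z ∙ t) ≡ false × B (z ∙ u) xor B (z ∙ (u ∙ t)) ≡ false) where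
        xor-false : ∀ {a b} → a xor b ≡ false → b ≡ a
        xor-false {false} e = e
        xor-false {true} {true} e = refl
        at-ε : ∀ {t} → t ∈ ts → A (g ∙ z ∙ (ε ∙ t)) ≡ B z
        at-ε {t} t∈ = trans
          (cong A (trans (assoc g z (ε ∙ t)) (cong (λ s → g ∙ (z ∙ s)) (identityˡ t))))
          (xor-false (proj₁ (same t∈)))
        at-u : ∀ {t} → t ∈ ts → A (g ∙ z ∙ (u ∙ t)) ≡ B (z ∙ u)
        at-u {t} t∈ = trans (cong A (assoc g z (u ∙ t))) (xor-false (proj₂ (same t∈)))
        ε-leaf : ∀ {t} → t ∈ ts → H (ε ∙ t) ≡ true × m * dist (ε ∙ t) ≤ suc d * # H
        ε-leaf {t} t∈ rewrite identityˡ t =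
          proj₁ (small t∈) , ≤-trans (coarse t∈) (m≤n+m (d * # H) (# H))
        u-leaf : ∀ {t} → t ∈ ts → H (u ∙ t) ≡ true × m * dist (u ∙ t) ≤ suc d * # H
        u-leaf {t} t∈ = ∙-closed hu (proj₁ (small t∈)) , (begin
          m * dist (u ∙ t)            ≤⟨ *-monoʳ-≤ m (dist-∙ t hu) ⟩
          m * (dist u + dist t)       ≡⟨ *-distribˡ-+ m _ _ ⟩
          m * dist u + m * dist t     ≤⟨ +-mono-≤ le (coarse t∈) ⟩
          suc d * # H                 ∎)
        -- Whether the sums with u or those without it form the related branch depends on the value
        -- of B at z.
        extend′ : ∀ b b′ → B z ≡ b → B (z ∙ u) ≡ b′ → b xor b′ ≡ true → PeriodTree m (suc d)
        extend′ true false e₀ e₁ _ =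
          branches ε u ts , length-branches ε u ts d len , ∈-branches⁻ ε u ts ε-leaf u-leaf ,
          joinTrees (g ∙ z) ε u tree λ t∈ → trans (at-ε t∈) e₀ , trans (at-u t∈) e₁
        extend′ false true e₀ e₁ _ =
          branches u ε ts , length-branches u ε ts d len , ∈-branches⁻ u ε ts u-leaf ε-leaf ,
          joinTrees (g ∙ z) u ε tree λ t∈ → trans (at-u t∈) e₁ , trans (at-ε t∈) e₀
      extend : ∀ z → B z xor B (z ∙ u) ≡ true →
        (∀ {t} → t ∈ ts → B z xor B (z ∙ t) ≡ false × B (z ∙ u) xor B (z ∙ (u ∙ t)) ≡ false) →
        PeriodTree m (suc d)
      extend z e same = extend′ e same (B z) (B (z ∙ u)) refl refl e

  -- Double counting of the pairs (a , h) with F a but not F (a ∙ h).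
  full-coset : ∀ {H S} (F : Fin n → Bool) η M → 0 < # S →
    (∀ {h} → S h ≡ true → η * M * # (λ x → H x ∧ (F x xor F (x ∙ h))) ≤ # H) →
    # H < M * # (λ x → H x ∧ F x) →
    ∃[ a ] H a ≡ true × η * # (λ h → S h ∧ not (F (a ∙ h))) < # S
  full-coset {H} {S} F η M 0<S periods dense =
    let a , lt = sum-<⇒∃< ∑<∑ in a , extract a lt
    where
    open ≤-Reasoning
    m = η * M
    HF : Fin n → Bool
    HF a = H a ∧ F a
    misses : Fin n → ℕ
    misses a = # λ h → S h ∧ not (F (a ∙ h))
    pointwise : ∀ a h → [ HF a ] * [ S h ∧ not (F (a ∙ h)) ] ≤
      [ S h ] * [ H a ∧ (F a xor F (a ∙ h)) ]
    pointwise a h with H a | F a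
    ... | false | _     = z≤n
    ... | true  | false = z≤n
    ... | true  | true  with S h
    ...   | false = z≤n
    ...   | true  = ≤-refl
    per-h : ∀ h → m * sum (λ a → [ HF a ] * [ S h ∧ not (F (a ∙ h)) ]) ≤ [ S h ] * # H
    per-h h = begin
      m * sum (λ a → [ HF a ] * [ S h ∧ not (F (a ∙ h)) ])
        ≤⟨ *-monoʳ-≤ m (sum-mono-≤ λ a → pointwise a h) ⟩
      m * sum (λ a → [ S h ] * [ H a ∧ (F a xor F (a ∙ h)) ])
        ≡⟨ cong (m *_) (*-distribˡ-sum [ S h ] (λ a → [ H a ∧ (F a xor F (a ∙ h)) ])) ⟨
      m * ([ S h ] * # (λ a → H a ∧ (F a xor F (a ∙ h))))
        ≤⟨ bound ⟩
      [ S h ] * # H ∎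
      where
      bound : m * ([ S h ] * # (λ a → H a ∧ (F a xor F (a ∙ h)))) ≤ [ S h ] * # H
      bound with S h in sh
      ... | false = ≤-reflexive (*-zeroʳ m)
      ... | true  = subst₂ (λ x y → m * x ≤ y) (sym (+-identityʳ _)) (sym (+-identityʳ _)) (periods sh)
    ∑<∑ : sum (λ a → m * ([ HF a ] * misses a)) < sum (λ a → [ HF a ] * (M * # S))
    ∑<∑ = begin-strict
      sum (λ a → m * ([ HF a ] * misses a))
        ≡⟨ *-distribˡ-sum m (λ a → [ HF a ] * misses a) ⟨
      m * sum (λ a → [ HF a ] * misses a)
        ≡⟨ cong (m *_) (sum-cong-≗ λ a → *-distribˡ-sum [ HF a ] (λ h → [ S h ∧ not (F (a ∙ h)) ])) ⟩
      m * sum (λ a → sum λ h → [ HF a ] * [ S h ∧ not (F (a ∙ h)) ])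
        ≡⟨ cong (m *_) (∑-comm (λ a h → [ HF a ] * [ S h ∧ not (F (a ∙ h)) ])) ⟩
      m * sum (λ h → sum λ a → [ HF a ] * [ S h ∧ not (F (a ∙ h)) ])
        ≡⟨ *-distribˡ-sum m (λ h → sum λ a → [ HF a ] * [ S h ∧ not (F (a ∙ h)) ]) ⟩
      sum (λ h → m * sum λ a → [ HF a ] * [ S h ∧ not (F (a ∙ h)) ])
        ≤⟨ sum-mono-≤ per-h ⟩
      sum (λ h → [ S h ] * # H)   ≡⟨ *-distribʳ-sum (# H) ([_] ∘ S) ⟨
      # S * # H                   <⟨ *-monoʳ-< (# S) {{>-nonZero 0<S}} dense ⟩
      # S * (M * # HF)            ≡⟨ rotate (# S) M (# HF) ⟩
      # HF * (M * # S)            ≡⟨ *-distribʳ-sum (M * # S) ([_] ∘ HF) ⟩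
      sum (λ a → [ HF a ] * (M * # S)) ∎
      where
      rotate : ∀ a b c → a * (b * c) ≡ c * (b * a)
      rotate = solve-∀
    extract : ∀ a → m * ([ HF a ] * misses a) < [ HF a ] * (M * # S) →
      H a ≡ true × η * misses a < # S
    extract a lt with HF a in e
    ... | false = contradiction lt λ ()
    ... | true  = proj₁ (∧-split e) , *-cancelˡ-< M _ _
      (subst₂ _<_ (regroup η M (misses a)) (+-identityʳ _) lt)
      where
      regroup : ∀ a b c → a * b * (c + 0) ≡ b * (a * c)
      regroup = solve-∀

  -- Descent through subgroups

  module _ (D : ℕ) (no-tree : ¬ Tree U U D) (M : ℕ) .{{_ : NonZero M}} where

    Good : (Fin n → Bool) → Set
    Good H = ∀ g → M * # (λ x → H x ∧ A (g ∙ x)) ≤ # H ⊎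
                   M * # (λ x → H x ∧ not (A (g ∙ x))) ≤ # H

    xor-not : ∀ a b → not a xor not b ≡ a xor b
    xor-not false b     = Bool.not-involutive b
    xor-not true  false = refl
    xor-not true  true  = refl

    -- S consists of the periods at a scale m′ with a gap. The upper bound on m′ controls the index
    -- of S; the lower bound makes S fine enough for `full-coset`, applied to B and to its
    -- complement, which have the same periods.
    split-subgroup : ∀ d {H} → IsSubgroup H → ∀ g →
      # H < M * # (λ x → H x ∧ A (g ∙ x)) →
      # H < M * # (λ x → H x ∧ not (A (g ∙ x))) →
      Σ[ S ∈ (Fin n → Bool) ] IsSubgroup S × (∀ {h} → S h ≡ true → H h ≡ true) ×
        # H ≤ stepLoss D M d * # S ×
        (∃[ a ] H a ≡ true × margin d * # (λ h → S h ∧ not (A (g ∙ (a ∙ h)))) < # S) ×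
        (∃[ b ] H b ≡ true × margin d * # (λ h → S h ∧ A (g ∙ (b ∙ h))) < # S)
    split-subgroup d {H} isSub g dense codense =
      construct (gap-or-tree D m {{m*n≢0 (margin d) M}})
      where
      open ≤-Reasoning
      open IsSubgroup isSub
      open Periods isSub g
      open Distance isSub B
      m = margin d * M
      Conclusion : (Fin n → Bool) → Set
      Conclusion S = IsSubgroup S × (∀ {h} → S h ≡ true → H h ≡ true) ×
        # H ≤ stepLoss D M d * # S ×
        (∃[ a ] H a ≡ true × margin d * # (λ h → S h ∧ not (A (g ∙ (a ∙ h)))) < # S) ×
        (∃[ b ] H b ≡ true × margin d * # (λ h → S h ∧ A (g ∙ (b ∙ h))) < # S)
      construct : (∃[ m′ ] m ≤ m′ × m′ ≤ m * gapLoss D × Gap m′) ⊎ PeriodTree m D → ∃ Conclusion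
      construct (inj₂ (_ , _ , _ , tree)) = contradiction (mapTree id _ D tree) no-tree
      construct (inj₁ (m′ , m≤m′ , m′≤ , gap)) =
        S , S-subgroup , (proj₁ ∘ stab⁻ m′) , size ,
        full-coset B (margin d) M S>0 periods dense ,
        (let b , hb , lt = full-coset (not ∘ B) (margin d) M S>0 periods-not codense in
         b , hb , subst (λ k → margin d * k < # S)
           (#-cong λ h → cong (S h ∧_) (Bool.not-involutive (B (b ∙ h)))) lt)
        where
        S : Fin n → Bool
        S = stab m′
        S-subgroup : IsSubgroup S
        S-subgroup = gap⇒subgroup {m′} gap
        S>0 : 0 < # S
        S>0 = IsSubgroup.#>0 S-subgroup
        periods : ∀ {h} → S h ≡ true → m * dist h ≤ # H
        periods {h} sh = ≤-trans (*-monoˡ-≤ (dist h) m≤m′) (proj₂ (stab⁻ m′ sh))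
        periods-not : ∀ {h} → S h ≡ true →
          m * # (λ x → H x ∧ (not (B x) xor not (B (x ∙ h)))) ≤ # H
        periods-not {h} sh = subst (λ k → m * k ≤ # H)
          (#-cong λ x → cong (H x ∧_) (sym (xor-not (B x) (B (x ∙ h))))) (periods sh)
        instance
          m′≢0 : NonZero m′
          m′≢0 = >-nonZero (<-≤-trans (>-nonZero⁻¹ m {{m*n≢0 (margin d) M}}) m≤m′)
        size : # H ≤ stepLoss D M d * # S
        size = begin
          # H
            -- The contrapositive of `packing` with L = H.
            ≤⟨ ≰⇒≥ (λ le → no-tree (mapTree id _ D (packing D H (λ _ → id) le))) ⟩
          (4 * m′) ^ D * (2 * # S)
            ≤⟨ *-monoˡ-≤ (2 * # S) (^-monoˡ-≤ D (*-monoʳ-≤ 4 m′≤)) ⟩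
          (4 * (m * gapLoss D)) ^ D * (2 * # S) ≡⟨ *-assoc ((4 * (m * gapLoss D)) ^ D) 2 (# S) ⟨
          stepLoss D M d * # S                 ∎
          where open Packing m′ using (packing)

    SubgroupTree : (Fin n → Bool) → ℕ → Set
    SubgroupTree H d = ∃[ ts ] length ts ≡ 2 ^ d ×
      (∀ {t} → t ∈ ts → H t ≡ true) × Tree U (_∈ ts) d

    -- If a translate of A is not nearly trivial on H, the search continues in S. A tree with leaves
    -- in S is copied to the cosets of a and b, nearly inside and nearly outside the translate. The
    -- new root is `g ∙ z`, where z in S is chosen so that no `z ∙ t` is an exception in either
    -- coset.
    good-or-tree : ∀ d {H} → IsSubgroup H →
      (Σ[ S ∈ (Fin n → Bool) ] IsSubgroup S × # H ≤ loss D M d * # S × Good S) ⊎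
      SubgroupTree H d
    good-or-tree zero isSub =
      inj₂ (ε ∷ [] , refl , (λ { (here refl) → IsSubgroup.ε-closed isSub }) , ε , here refl)
    good-or-tree (suc d) {H} isSub
      with any? (λ g → (# H <? M * # (λ x → H x ∧ A (g ∙ x))) ×-dec
                       (# H <? M * # (λ x → H x ∧ not (A (g ∙ x)))))
    ... | no ¬g = inj₁ (H , isSub , m≤n*m (# H) (loss D M (suc d)) {{loss≢0 (suc d)}} , good)
      where
      loss≢0 : ∀ d → NonZero (loss D M d)
      loss≢0 zero    = _
      loss≢0 (suc d) = m*n≢0 (stepLoss D M d) (loss D M d) {{m*n≢0 (k ^ D) 2 {{m^n≢0 k D}}}} {{loss≢0 d}}
        where
        k = 4 * (margin d * M * gapLoss D)
        instance
          k≢0 : NonZero k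
          k≢0 = m*n≢0 4 (margin d * M * gapLoss D)
            {{_}} {{m*n≢0 (margin d * M) (gapLoss D) {{m*n≢0 (margin d) M}} {{gapLoss≢0 D}}}}
      good : Good H
      good g with M * # (λ x → H x ∧ A (g ∙ x)) ≤? # H
      ... | yes le = inj₁ le
      ... | no ≰   = inj₂ (≮⇒≥ λ lt → ¬g (g , ≰⇒> ≰ , lt))
    ... | yes (g , dense , codense) with split-subgroup d isSub g dense codense
    ...   | S , S-subgroup , S⊆H , size , (a , ha , full) , (b , hb , empty)
      with good-or-tree d S-subgroup
    ...     | inj₁ (S′ , S′-subgroup , size′ , good) =
      inj₁ (S′ , S′-subgroup , (begin
        # H                                      ≤⟨ size ⟩
        stepLoss D M d * # S                     ≤⟨ *-monoʳ-≤ (stepLoss D M d) size′ ⟩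
        stepLoss D M d * (loss D M d * # S′)     ≡⟨ *-assoc (stepLoss D M d) (loss D M d) (# S′) ⟨
        loss D M (suc d) * # S′                  ∎) , good)
      where open ≤-Reasoning
    ...     | inj₂ (ts , len , ts⊆S , tree) =
      inj₂ (branches a b ts , length-branches a b ts d len ,
        ∈-branches⁻ a b ts (λ t∈ → ∙-closed ha (S⊆H (ts⊆S t∈))) (λ t∈ → ∙-closed hb (S⊆H (ts⊆S t∈))) ,
        (let z , sz , ¬bad = node in
         joinTrees (g ∙ z) a b tree λ {t} t∈ →
           let in-A , off-A = ∨-false (∧-false sz (¬bad t∈))
           in trans (cong A (rearrange a z t)) (trans (sym (Bool.not-involutive _)) (cong not in-A)) ,
              trans (cong A (rearrange b z t)) off-A))
      where
      open IsSubgroup isSub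
      module S = IsSubgroup S-subgroup
      ∧-false : ∀ {a b} → a ≡ true → a ∧ b ≡ false → b ≡ false
      ∧-false refl e = e
      ∨-false : ∀ {a b} → a ∨ b ≡ false → a ≡ false × b ≡ false
      ∨-false {false} e = refl , e
      rearrange : ∀ a z t → g ∙ z ∙ (a ∙ t) ≡ g ∙ (a ∙ (z ∙ t))
      rearrange a z t = begin
        g ∙ z ∙ (a ∙ t)     ≡⟨ assoc g z (a ∙ t) ⟩
        g ∙ (z ∙ (a ∙ t))   ≡⟨ cong (g ∙_) (assoc z a t) ⟨
        g ∙ (z ∙ a ∙ t)     ≡⟨ cong (λ w → g ∙ (w ∙ t)) (comm z a) ⟩
        g ∙ (a ∙ z ∙ t)     ≡⟨ cong (g ∙_) (assoc a z t) ⟩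
        g ∙ (a ∙ (z ∙ t))   ∎
        where open ≡-Reasoning
      bad : Fin n → Fin n → Bool
      bad t z = S z ∧ (not (A (g ∙ (a ∙ (z ∙ t)))) ∨ A (g ∙ (b ∙ (z ∙ t))))
      bad-small : ∀ {t} → t ∈ ts → margin d * # (bad t) ≤ 2 * # S
      bad-small {t} t∈ = begin
        margin d * # (bad t)
          ≤⟨ *-monoʳ-≤ (margin d)
               (#-cover {R = λ z → S z ∧ A (g ∙ (b ∙ (z ∙ t)))} λ z → ∧-∨-cases {S z}) ⟩
        margin d * (# (λ z → S z ∧ not (A (g ∙ (a ∙ (z ∙ t))))) + # (λ z → S z ∧ A (g ∙ (b ∙ (z ∙ t)))))
          ≡⟨ cong (margin d *_) (cong₂ _+_
               (S.#-translate-∧ (λ z → not (A (g ∙ (a ∙ z)))) (ts⊆S t∈))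
               (S.#-translate-∧ (λ z → A (g ∙ (b ∙ z))) (ts⊆S t∈))) ⟩
        margin d * (# (λ z → S z ∧ not (A (g ∙ (a ∙ z)))) + # (λ z → S z ∧ A (g ∙ (b ∙ z))))
          ≡⟨ *-distribˡ-+ (margin d)
               (# (λ z → S z ∧ not (A (g ∙ (a ∙ z))))) (# (λ z → S z ∧ A (g ∙ (b ∙ z)))) ⟩
        margin d * # (λ z → S z ∧ not (A (g ∙ (a ∙ z)))) + margin d * # (λ z → S z ∧ A (g ∙ (b ∙ z)))
          ≤⟨ +-mono-≤ (<⇒≤ full) (<⇒≤ empty) ⟩
        # S + # S   ≡⟨ cong (# S +_) (+-identityʳ (# S)) ⟨
        2 * # S     ∎
        where
        open ≤-Reasoning
      node : ∃[ z ] S z ≡ true × (∀ {t} → t ∈ ts → bad t z ≡ false)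
      node = union-bound {P = S} bad (margin d) (2 * # S) ts bad-small (begin-strict
        length ts * (2 * # S)   ≡⟨ cong (_* (2 * # S)) len ⟩
        2 ^ d * (2 * # S)       ≡⟨ *-assoc (2 ^ d) 2 (# S) ⟨
        2 ^ d * 2 * # S         <⟨ m<n+m _ S.#>0 ⟩
        margin d * # S          ∎)
        where open ≤-Reasoning

    -- D unsuccessful levels starting from the whole group would give a tree of the excluded height
    -- D.
    regularity : Σ[ S ∈ (Fin n → Bool) ] IsSubgroup S × n ≤ loss D M D * # S × Good S
    regularity with good-or-tree D everything
    ... | inj₁ (S , isSub , size , good) =
      S , isSub , subst (_≤ loss D M D * # S) (#-true n) size , good
    ... | inj₂ (_ , _ , _ , tree) = contradiction (mapTree id _ D tree) no-tree

-- Transport to the given group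

open Reals
open import Data.Rational.Base as ℚ using (½)
import Data.Rational.Properties as ℚ
open import Algebra.Definitions.RawSemiring ℚ.+-*-rawSemiring using () renaming (_^_ to infixr 8 _^ℚ_)

module _ {a p : Level} {A : Set a} where

  length-filter-tabulate : ∀ {n} {P : Pred A p} (P? : Decidable P) (f : Fin n → A) →
    length (filter P? (tabulate f)) ≡ # λ i → does (P? (f i))
  length-filter-tabulate {zero}  P? f = refl
  length-filter-tabulate {suc n} P? f with does (P? (f zero))
  ... | true  = cong suc (length-filter-tabulate P? (f ∘ suc))
  ... | false = length-filter-tabulate P? (f ∘ suc)

  -- Each kept element filters out the later ones related to it, so the representatives counted by
  -- `index` are pairwise incongruent.
  deduplicate-AllPairs : ∀ {R : A → A → Set p} (R? : Decidable₂ R) xs →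
    AllPairs (λ x y → ¬ R x y) (deduplicate R? xs)
  deduplicate-AllPairs R? []       = []
  deduplicate-AllPairs R? (x ∷ xs) =
    all-filter (¬? ∘ R? x) (deduplicate R? xs) ∷
    AllPairs.filter⁺ (¬? ∘ R? x) (deduplicate-AllPairs R? xs)

does-≟-true : ∀ b → does (b Bool.≟ true) ≡ b
does-≟-true false = refl
does-≟-true true  = refl

does≡true⇒ : ∀ {a} {P : Set a} (P? : Dec P) → does P? ≡ true → P
does≡true⇒ (yes p) _ = p

module Transport {c ℓ p : Level} (G : FiniteAbelianGroup c ℓ) (A : Subset G p) where
  open FiniteAbelianGroup G hiding (refl; sym; trans; isEquivalence)
  private module G = FiniteAbelianGroup G
  open Inverse enumeration using (to; from; from-cong; strictlyInverseˡ; strictlyInverseʳ)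
  open Subset A using (member; respects; member?)

  -- The group law carried over to indices, where equality is propositional and cardinalities are
  -- sums of indicators.
  infixl 6 _⊕_
  _⊕_ : Fin order → Fin order → Fin order
  i ⊕ j = from (to i +ᴳ to j)

  ⊖_ : Fin order → Fin order
  ⊖ i = from (-ᴳ to i)

  from-+ : ∀ x y → from (x +ᴳ y) ≡ from x ⊕ from y
  from-+ x y = from-cong (G.sym (∙-cong (strictlyInverseˡ x) (strictlyInverseˡ y)))

  from-neg : ∀ x → from (-ᴳ x) ≡ ⊖ from x
  from-neg x = from-cong (G.sym (⁻¹-cong (strictlyInverseˡ x)))

  ⊕-isAbelianGroup : IsAbelianGroup _≡_ _⊕_ (from 0ᴳ) ⊖_
  ⊕-isAbelianGroup = record
    { isGroup = record
      { isMonoid = record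
        { isSemigroup = record
          { isMagma = record { isEquivalence = isEquivalence ; ∙-cong = cong₂ _⊕_ }
          ; assoc   = λ i j k → from-cong (G.trans (∙-congʳ (strictlyInverseˡ _))
                        (G.trans (assoc (to i) (to j) (to k)) (∙-congˡ (G.sym (strictlyInverseˡ _)))))
          }
        ; identity = (λ i → trans (from-cong (G.trans (∙-congʳ (strictlyInverseˡ 0ᴳ)) (identityˡ (to i))))
                            (strictlyInverseʳ i))
                   , (λ i → trans (from-cong (G.trans (∙-congˡ (strictlyInverseˡ 0ᴳ)) (identityʳ (to i))))
                            (strictlyInverseʳ i))
        }
      ; inverse = (λ i → from-cong (G.trans (∙-congʳ (strictlyInverseˡ _)) (inverseˡ (to i))))
                , (λ i → from-cong (G.trans (∙-congˡ (strictlyInverseˡ _)) (inverseʳ (to i))))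
      ; ⁻¹-cong = cong ⊖_
      }
    ; comm = λ i j → from-cong (comm (to i) (to j))
    }

  open FinGroup ⊕-isAbelianGroup public
    using (IsSubgroup; module IsSubgroup; everything; distinct-cosets)
  open Trees

  A′ : Fin order → Bool
  A′ i = does (member? (to i))

  A′-from : ∀ x → A′ (from x) ≡ does (member? x)
  A′-from x = does-⇔ (mk⇔ (respects (strictlyInverseˡ x)) (respects (G.sym (strictlyInverseˡ x))))
    (member? (to (from x))) (member? x)

  -- A ladder of length k for the relation A (x + y) is an instance of the k-order property.
  stable⇒no-tree : ∀ k → Stable k A → ¬ Tree (λ i j → A′ (i ⊕ j)) U U (ladderHeight k)
  stable⇒no-tree k stable t =
    let a , b , _ , _ , ab = tree⇒ladder (λ i j → A′ (i ⊕ j)) k t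
    in stable (to ∘ a , to ∘ b , λ i j → mk⇔
         (λ m → Equivalence.to (ab i j) (trans (A′-from _) (dec-true (member? _) m)))
         (λ le → does≡true⇒ (member? _) (trans (sym (A′-from _)) (Equivalence.from (ab i j) le))))

  module _ {S : Fin order → Bool} (isSub : IsSubgroup S) where
    open IsSubgroup isSub

    H : Subgroup G (c ⊔ ℓ ⊔ p)
    H = record
      { subset = record
        { member   = λ x → Lift (c ⊔ ℓ ⊔ p) (S (from x) ≡ true)
        ; respects = λ x≈y (lift e) → lift (trans (cong S (sym (from-cong x≈y))) e)
        ; member?  = λ x → map′ lift Lift.lower (S (from x) Bool.≟ true)
        }
      ; 0-closed   = lift ε-closed
      ; +-closed   = λ {x} {y} (lift e) (lift f) → lift (trans (cong S (from-+ x y)) (∙-closed e f))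
      ; neg-closed = λ {x} (lift e) → lift (trans (cong S (from-neg x)) (⁻¹-closed e))
      }

    open Subgroup H using (subset; index) renaming (member? to member-H?)

    does-H : ∀ i → does (member-H? (to i)) ≡ S i
    does-H i = trans (does-≟-true _) (cong S (strictlyInverseʳ i))

    does-A : ∀ g i → does (Subset.member? (A -ˢ g) (to i)) ≡ A′ (from g ⊕ i)
    does-A g i = begin
      does (member? (to i +ᴳ g))   ≡⟨ A′-from _ ⟨
      A′ (from (to i +ᴳ g))
        ≡⟨ cong A′ (from-cong (G.trans (comm _ _) (∙-congʳ (G.sym (strictlyInverseˡ g))))) ⟩
      A′ (from g ⊕ i)              ∎
      where open ≡-Reasoning

    ∣H∣ : ∣ subset ∣ ≡ # S
    ∣H∣ = trans (length-filter-tabulate member-H? to) (#-cong does-H)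

    ∣A∩H∣ : ∀ g → ∣ (A -ˢ g) ∩ˢ subset ∣ ≡ # λ i → S i ∧ A′ (from g ⊕ i)
    ∣A∩H∣ g = trans (length-filter-tabulate (Subset.member? ((A -ˢ g) ∩ˢ subset)) to)
      (#-cong λ i → trans (cong₂ _∧_ (does-A g i) (does-H i)) (Bool.∧-comm _ (S i)))

    ∣H∖A∣ : ∀ g → ∣ subset ∖ˢ (A -ˢ g) ∣ ≡ # λ i → S i ∧ not (A′ (from g ⊕ i))
    ∣H∖A∣ g = trans (length-filter-tabulate (Subset.member? (subset ∖ˢ (A -ˢ g))) to)
      (#-cong λ i → cong₂ (λ a b → a ∧ not b) (does-H i) (does-A g i))

    index*# : index * # S ≤ order
    index*# = subst (λ k → k * # S ≤ order) (length-map from reps)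
      (distinct-cosets isSub (AllPairs.map⁺ (AllPairs.map
        (λ {x} {y} ¬H e → ¬H (lift (trans
          (cong S (trans (from-+ x (-ᴳ y)) (cong (from x ⊕_) (from-neg y)))) e)))
        (deduplicate-AllPairs (λ x y → member-H? (x -ᴳ y)) elements))))
      where
      reps = deduplicate (λ x y → member-H? (x -ᴳ y)) elements

    index≤ : ∀ {N} → order ≤ N * # S → index ≤ N
    index≤ {N} le = *-cancelʳ-≤ index N (# S) {{>-nonZero #>0}} (≤-trans index*# le)

    dichotomy : ∀ (μ : ℝ) j → ℝ.lower μ (½ ^ℚ j) →
      (∀ g → 2 ^ j * # (λ i → S i ∧ A′ (g ⊕ i)) ≤ # S ⊎
             2 ^ j * # (λ i → S i ∧ not (A′ (g ⊕ i))) ≤ # S) →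
      ∀ g → ⟦ ∣ (A -ˢ g) ∩ˢ subset ∣ ⟧ ≤ᶜ μ · ∣ subset ∣ ⊎
            ⟦ ∣ subset ∖ˢ (A -ˢ g) ∣ ⟧ ≤ᶜ μ · ∣ subset ∣
    dichotomy μ j l good g = Sum.map
      (λ le → ⟦⟧≤· μ j {∣ (A -ˢ g) ∩ˢ subset ∣} {∣ subset ∣} l
        (subst₂ (λ a b → 2 ^ j * a ≤ b) (sym (∣A∩H∣ g)) (sym ∣H∣) le))
      (λ le → ⟦⟧≤· μ j {∣ subset ∖ˢ (A -ˢ g) ∣} {∣ subset ∣} l
        (subst₂ (λ a b → 2 ^ j * a ≤ b) (sym (∣H∖A∣ g)) (sym ∣H∣) le))
      (good (from g))

-- Since ½ ≤ ¾, 2^(3+i) bounds 1/μ when ¾^(3+i) < μ.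
loss-bound : ∀ D → ∃[ E ] (∀ i → loss D (2 ^ (3 + i)) D ≤ 2 ^ (suc i * E))
loss-bound D with loss-polynomial D D
... | c , e , eq = c + 3 * e , λ i → begin
  loss D (2 ^ (3 + i)) D           ≡⟨ eq (2 ^ (3 + i)) ⟩
  c * (2 ^ (3 + i)) ^ e            ≡⟨ cong (c *_) (^-*-assoc 2 (3 + i) e) ⟩
  c * 2 ^ ((3 + i) * e)
    -- The constant is absorbed through `c ≤ 2 ^ c`, since the exponent carries the factor
    -- `suc i ≥ 1`.
    ≤⟨ *-mono-≤ (≤-trans (n≤2^n c) (^-monoʳ-≤ 2 (m≤n*m c (suc i))))
                (^-monoʳ-≤ 2 (*-monoˡ-≤ e (3+i≤ i))) ⟩
  2 ^ (suc i * c) * 2 ^ (3 * suc i * e)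
    ≡⟨ ^-distribˡ-+-* 2 (suc i * c) (3 * suc i * e) ⟨
  2 ^ (suc i * c + 3 * suc i * e)  ≡⟨ cong (2 ^_) (regroup (suc i) c e) ⟩
  2 ^ (suc i * (c + 3 * e))        ∎
  where
  open ≤-Reasoning
  3+i≤ : ∀ i → 3 + i ≤ 3 * suc i
  3+i≤ i = ≤-trans (+-monoʳ-≤ 3 (m≤n*m i 3)) (≤-reflexive (sym (*-suc 3 i)))
  regroup : ∀ a b c → a * b + 3 * a * c ≡ a * (b + 3 * c)
  regroup = solve-∀

-- Large and small μ

module _ {c ℓ p : Level} (G : FiniteAbelianGroup c ℓ) (A : Subset G p) where
  open Transport G A

  Regular : ℝ → ℝ → Subgroup G (c ⊔ ℓ ⊔ p) → Set c
  Regular μ M H = let open Subgroup H in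
    ⟦ index ⟧ ≤ᶜ exp (μ ^- M) ×
    (∀ (g : FiniteAbelianGroup.Carrier G) →
      ⟦ ∣ (A -ˢ g) ∩ˢ subset ∣ ⟧ ≤ᶜ μ · ∣ subset ∣ ⊎
      ⟦ ∣ subset ∖ˢ (A -ˢ g) ∣ ⟧ ≤ᶜ μ · ∣ subset ∣)

  -- For μ near 1 the bound exp (μ^-M) stays near e and cannot absorb constants. The whole group, of
  -- index 1, is taken instead: a set or its complement has density at most ½ < μ.
  regular-½ : ∀ μ m → 0 < m → ℝ.lower μ ½ → μ <1 → Regular μ (ℕ→ℝ m) (H everything)
  regular-½ μ m 0<m ½<μ μ<1 =
    (λ {q} q<index → ⟦1⟧≤exp μ m 0<m μ<1 {q}
      (ℚ.<-≤-trans q<index (ι-mono-≤ {Subgroup.index (H everything)} {1} index≤1))) ,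
    dichotomy everything μ 1 ½<μ (λ g → #-half (λ i → A′ (g ⊕ i)))
    where
    index≤1 : Subgroup.index (H everything) ≤ 1
    index≤1 = index≤ everything (≤-reflexive (trans (sym (#-true _)) (sym (*-identityˡ _))))

  -- The lower bound on μ justifies the tolerance ½^(3+i) ≤ ¾^(3+i) < μ; the upper bound makes exp
  -- (μ^-M) exceed the resulting index.
  regular-small : ∀ k E →
    (∀ i → loss (ladderHeight k) (2 ^ (3 + i)) (ladderHeight k) ≤ 2 ^ (suc i * E)) →
    Stable k A → ∀ μ i → ℝ.upper μ (¾ ^ℚ suc i) → ℝ.lower μ (¾ ^ℚ (3 + i)) →
    ∃ (Regular μ (ℕ→ℝ (suc (suc (3 * E)))))
  regular-small k E bound stable μ i u l =
    let S , isSub , size , good = Regularity.regularity ⊕-isAbelianGroup A′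
           (ladderHeight k) (stable⇒no-tree k stable) (2 ^ (3 + i)) {{m^n≢0 2 (3 + i)}}
    in H isSub ,
    ⟦⟧≤exp E i μ {Subgroup.index (H isSub)} u (≤-trans (index≤ isSub size) (bound i)) ,
    dichotomy isSub μ (3 + i) (lower-≤ μ (½^≤¾^ (3 + i)) l) good

theorem4 : ∀ {c ℓ p} (k : ℕ) → 2 ≤ k →
    Σ[ M ∈ ℝ ] 0< M ×
    (∀ (μ : ℝ) → 0< μ → μ <1 →
    ∃[ M₀ ] (∀ (G : FiniteAbelianGroup c ℓ) (A : Subset G p) →
    M₀ ≤ FiniteAbelianGroup.order G →
    Stable k A →
    Σ[ H ∈ Subgroup G (c ⊔ ℓ ⊔ p) ]
    ⟦ Subgroup.index H ⟧ ≤ᶜ exp (μ ^- M) ×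
    (∀ (g : FiniteAbelianGroup.Carrier G) → let open Subgroup H in
    ⟦ ∣ (A -ˢ g) ∩ˢ subset ∣ ⟧ ≤ᶜ μ · ∣ subset ∣ ⊎
    ⟦ ∣ subset ∖ˢ (A -ˢ g) ∣ ⟧ ≤ᶜ μ · ∣ subset ∣)))
theorem4 {c} {ℓ} {p} k _ =
  let D = ladderHeight k
      E , bound = loss-bound D
      -- The part 3E absorbs the powers of 2, one unit makes the comparison with 1 strict, and one
      -- leaves the exponent 3E + 1 strictly below M.
      m = suc (suc (3 * E))
  in ℕ→ℝ m , ι-mono-< {0} {m} z<s , λ μ 0<μ μ<1 → 0 , λ G A _ stable →
     -- Locatedness requires overlapping cases: μ > ½ or μ < ¾.
     Sum.[ (λ ½<μ → Transport.H G A (Transport.everything G A) ,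
                    regular-½ G A μ m z<s ½<μ μ<1)
         , (λ μ<¾ → let i , u , l = bracket μ 0<μ μ<¾
                    in regular-small G A k E bound stable μ i u l)
         ]′ (ℝ.located μ {½} {¾ ^ℚ 1} ½<¾)
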